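{- For every pair of integers $r, k \ge 3$, there exists $C = C(r,k) > 0$ such that for all $n \in \mathbb{N}$, the number of $C^r_k$-free $r$-uniform hypergraphs on the vertex set $[n]=\{1,\dots,n\}$ is at most $2^{C n^{r-1}}$; that is, $|\mathrm{Forb}_r(n, C^r_k)| \le 2^{C n^{r-1}}$.
   Context: An $r$-uniform hypergraph ($r$-graph) is a pair $(V,E)$ of finite sets with $E$ a family of $r$-element subsets of $V$. For integers $r \ge 2$ and $k \ge 3$, the $r$-uniform linear $k$-cycle $C^r_k$ is the $r$-graph on $k(r-1)$ vertices whose vertices can be ordered cyclically so that its edges (exactly $k$ of them) are sets of $r$ consecutive vertices in this ordering and every two consecutive edges share exactly one vertex. $\mathrm{Forb}_r(n,H)$ denotes the family of all $r$-graphs on vertex set $[n]$ containing no copy of $H$ as a subgraph (i.e., $H$-free). -}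

module Defs where

open import Data.Nat using (ℕ; _+_; _*_; _∸_; _^_; _<_; _≤_)
open import Data.Fin using (Fin; toℕ)
open import Data.Fin.Subset using (Subset; _∈_; ∣_∣)
open import Data.Bool using (Bool; true)
open import Data.Product using (Σ; ∃; _×_)
open import Data.Sum using (_⊎_)
open import Relation.Binary.PropositionalEquality using (_≡_)
open import Relation.Nullary using (¬_)
open import Function.Definitions using (Injective)

record RGraph (r n : ℕ) : Set where
  field
    edge    : Subset n → Bool
    uniform : ∀ S → edge S ≡ true → ∣ S ∣ ≡ r
open RGraph public

-- Vertices of the linear cycle C^r_k are 0 , … , k(r-1)-1 in cyclic order.
-- Edge i (0 ≤ i < k) consists of the r consecutive vertices
--   i(r-1), i(r-1)+1, … , i(r-1)+(r-1)   (taken modulo k(r-1)).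
-- Since i(r-1)+t ≤ k(r-1), reduction mod k(r-1) is either trivial or
-- subtracts k(r-1) exactly once.
CycEdge : (r k : ℕ) → Fin k → Fin (k * (r ∸ 1)) → Set
CycEdge r k i j =
  ∃ λ (t : Fin r) →
    (toℕ i * (r ∸ 1) + toℕ t ≡ toℕ j)
    ⊎ (toℕ i * (r ∸ 1) + toℕ t ≡ toℕ j + k * (r ∸ 1))

ContainsCycle : (r k : ℕ) {n : ℕ} → RGraph r n → Set
ContainsCycle r k {n} H =
  Σ (Fin (k * (r ∸ 1)) → Fin n) λ φ →
    Injective _≡_ _≡_ φ ×
    (∀ (i : Fin k) → Σ (Subset n) λ S →
        (edge H S ≡ true) ×
        (∀ v → v ∈ S → ∃ λ j → CycEdge r k i j × φ j ≡ v) ×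
        (∀ j → CycEdge r k i j → φ j ∈ S))

Forb : (r n k : ℕ) → Set
Forb r n k = Σ (RGraph r n) λ H → ¬ ContainsCycle r k H

SameEdges : {r n : ℕ} → RGraph r n → RGraph r n → Set
SameEdges {r} {n} H H' = ∀ (S : Subset n) → edge H S ≡ edge H' S

CardAtMost : (r n k : ℕ) → ℕ → Set
CardAtMost r n k N =
  Σ (Forb r n k → Fin N) λ code →
    ∀ (A B : Forb r n k) → code A ≡ code B →
      SameEdges (Data.Product.proj₁ A) (Data.Product.proj₁ B)

-- A C_k-free r-graph is encoded by O(n^(r-1)) bits.
--
-- Call an r-graph full if all (r-1)-subsets of its edges have large codegree.  A full r-graph
-- contains every linear cycle, so a C_k-free r-graph can be peeled: it becomes a system of
-- (r-1)-tuples, each carrying boundedly many colours (the r-th vertices).  Cut [n] into intervals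
-- of length q = b^i.  Among the q^(r-1) tuples of a box of intervals only O(q^(r-1) / 2^i)
-- intervals of colours can occur: otherwise picking one tuple for each interval gives a rainbow
-- (r-1)-graph that is dense enough to contain a cycle, and adding the colours makes it a C_k.
-- So the projection of the system to the intervals of length q has O(n^(r-1) / 2^i) tuples, and
-- recording the projections from coarse to fine costs a geometric sum.
--
-- For r >= 4 the dense (r-1)-graph contains C_k because it has a full subgraph.  For r = 3 it is a
-- graph and contains K_{t,t} (Kővári, Sós, Turán), hence all short even cycles.  If k is odd, call
-- x, y linked if they are joined by a path of length k - 2 avoiding any three given vertices.
-- Around a linked pair the link graphs are so restricted that the edges containing it are
-- determined by four graphs on [n].  The other edges contain no robust even cycle and are treated
-- as before when k >= 5.  When k = 3 they have codegree at most 3, so they split into boundedly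
-- many linear hypergraphs, each of which is determined by its shadow.

{-# OPTIONS --safe #-}
module Submission where

open import Defs
open import Data.Bool.Base using (Bool; true; false; _∧_; if_then_else_)
import Data.Bool.Properties as Boolₚ
open import Data.Empty using (⊥; ⊥-elim)
open import Data.Fin.Base using (Fin; zero; suc; toℕ; combine; remQuot; fromℕ<)
open import Data.Fin.Properties using (toℕ-combine; combine-remQuot; toℕ-fromℕ<; toℕ-injective; toℕ<n; ¬∀⟶∃¬; combine-injective) renaming (suc-injective to Fin-suc-injective; all? to Fin-all?)
open import Data.Fin.Subset using (Subset; inside; outside; ∣_∣) renaming (_∈_ to _∈ₛ_)
open import Data.List.Base as List using (List; []; _∷_; [_]; _++_; length; map; concatMap; upTo; allFin)
open import Data.List.Properties using (length-map; length-++; length-upTo; length-tabulate; map-cong; ++-assoc; ++-identityʳ; ∷-injective)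
open import Data.List.Membership.Propositional using (_∈_; _∉_; lose; find)
open import Data.List.Membership.Propositional.Properties using (∈-map⁺; ∈-map⁻; ∈-upTo⁺; ∈-upTo⁻; ∈-++⁻; ∈-++⁺ˡ; ∈-++⁺ʳ; ∈-allFin; ∈-concat⁺′)
open import Data.List.Relation.Unary.All as All using (All; []; _∷_; all?)
import Data.List.Relation.Unary.All.Properties as Allₚ
open import Data.List.Relation.Unary.AllPairs using ([]; _∷_)
open import Data.List.Relation.Unary.Any using (Any; here; there; any?)
open import Data.List.Relation.Unary.Unique.Propositional using (Unique)
import Data.List.Relation.Unary.Unique.Propositional.Properties as Uniqueₚ
import Data.List.Relation.Binary.Permutation.Propositional as Perm
open import Data.List.Relation.Binary.Permutation.Propositional using (_↭_; ↭-sym; ↭-refl; ↭-trans)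
open import Data.List.Relation.Binary.Permutation.Propositional.Properties using (All-resp-↭; ∈-resp-↭; ++⁺ʳ; ∷↭∷ʳ) renaming (map⁺ to ↭-map⁺)
open import Data.Nat
open import Data.Nat.DivMod
open import Data.Nat.Properties
open import Data.Nat.Tactic.RingSolver using (solve-∀)
open import Data.List.Membership.DecPropositional _≟_ using (_∈?_)
open import Data.List.Relation.Unary.Unique.DecPropositional _≟_ using (unique?)
open import Data.Product using (∃; ∃₂; _×_; _,_; proj₁; proj₂)
open import Data.Sum using (_⊎_; inj₁; inj₂; swap; [_,_]′)
open import Data.Unit.Base using (⊤; tt)
open import Data.Vec.Base as Vec using (Vec; []; _∷_; toList; fromList; lookup; concat; tabulate; head; zipWith; replicate; insertAt; removeAt; _[_]≔_)
open import Data.Vec.Properties using (lookup-concat; lookup∘tabulate; tabulate-cong; tabulate-∘; tabulate∘lookup; lookup-zipWith; lookup∘update; lookup∘update′; []≔-idempotent; []=⇒lookup; lookup⇒[]=; toList-++; toList-map; toList∘fromList; insertAt-removeAt; ≡-dec) renaming (++-injective to Vec-++-injective; ∷-injective to Vec-∷-injective)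
open import Data.Vec.Relation.Unary.All as VAll using ([]; _∷_) renaming (All to VAll)
open import Function.Base using (_∘_; id)
open import Relation.Binary.Definitions using (DecidableEquality; tri<; tri≈; tri>)
open import Relation.Binary.PropositionalEquality hiding ([_])
open import Relation.Nullary
open import Relation.Nullary.Decidable using (dec-true; map′; _×-dec_; _⊎-dec_)

-- The geometric sum requires a rainbow graph in a box of side `q = b ^ i` to have density only
-- O(2^-i). When r >= 4 the absence of a full subgraph saves a whole factor q, so b = 2 does. A fan
-- needs three slots, which a graph lacks; for r = 3 excluding a biclique saves only a small power
-- of q, and b is chosen so large that this power is still 2^i. The further obstacle for r = 3 is
-- parity. A biclique supplies paths of odd length between its two sides, but no odd cycles. For
-- even k a path of length k - 1 together with one edge through its ends is already a cycle. For odd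
-- k the available length is k - 2, and the return must use two edges that meet in a vertex z
-- outside the path: one at x and one at y in the link graph of z. Such a detour has three vertices
-- besides x and y, which are the three vertices that the path must be able to avoid. Forbidding it
-- forces the link of z to be nearly trivial around x and y, so that degrees 0, 1 and at least 2
-- almost reveal whether xyz is an edge.

private variable
  A B X : Set
  k m n r s M M′ : ℕ
  T T′ : X → X → Set

does⇒ : (d : Dec A) → does d ≡ true → A
does⇒ (yes a) _ = a

bool-ext : ∀ {a b} → (a ≡ true → b ≡ true) → (b ≡ true → a ≡ true) → a ≡ b
bool-ext {false} {false} f g = refl
bool-ext {false} {true}  f g = g refl
bool-ext {true}          f g = sym (f refl)

-- Finite sums and counting

∑ : List A → (A → ℕ) → ℕ
∑ []       f = 0
∑ (x ∷ xs) f = f x + ∑ xs f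

ind : Bool → ℕ
ind true  = 1
ind false = 0

♯ : (A → Bool) → List A → ℕ
♯ p xs = ∑ xs (ind ∘ p)

select : (A → Bool) → List A → List A
select p []       = []
select p (x ∷ xs) = if p x then x ∷ select p xs else select p xs

length-select : (p : A → Bool) (xs : List A) → length (select p xs) ≡ ♯ p xs
length-select p []       = refl
length-select p (x ∷ xs) with p x
... | true  = cong suc (length-select p xs)
... | false = length-select p xs

∈-select⁻ : (p : A → Bool) (xs : List A) {x : A} → x ∈ select p xs → x ∈ xs × p x ≡ true
∈-select⁻ p (y ∷ xs) x∈ with p y in eq
∈-select⁻ p (y ∷ xs) (here refl) | true = here refl , eq
∈-select⁻ p (y ∷ xs) (there x∈)  | true = let a , b = ∈-select⁻ p xs x∈ in there a , b
... | false = let a , b = ∈-select⁻ p xs x∈ in there a , b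

∈-select⁺ : (p : A → Bool) {xs : List A} {x : A} → x ∈ xs → p x ≡ true → x ∈ select p xs
∈-select⁺ p (here {x = y} refl) px with p y
∈-select⁺ p (here refl) refl | true = here refl
∈-select⁺ p {y ∷ xs} (there x∈) px with p y
... | true  = there (∈-select⁺ p x∈ px)
... | false = ∈-select⁺ p x∈ px

select-All : {P : A → Set} (p : A → Bool) {xs : List A} → All P xs → All P (select p xs)
select-All p [] = []
select-All p {x ∷ xs} (a ∷ as) with p x
... | true  = a ∷ select-All p as
... | false = select-All p as

select-Unique : (p : A → Bool) {xs : List A} → Unique xs → Unique (select p xs)
select-Unique p [] = []
select-Unique p {x ∷ xs} (a ∷ u) with p x
... | true  = select-All p a ∷ select-Unique p u
... | false = select-Unique p u

∑-cong : (xs : List A) {f g : A → ℕ} → (∀ x → f x ≡ g x) → ∑ xs f ≡ ∑ xs g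
∑-cong []       e = refl
∑-cong (x ∷ xs) e = cong₂ _+_ (e x) (∑-cong xs e)

∑-mono : (xs : List A) {f g : A → ℕ} → (∀ {x} → x ∈ xs → f x ≤ g x) → ∑ xs f ≤ ∑ xs g
∑-mono []       h = z≤n
∑-mono (x ∷ xs) h = +-mono-≤ (h (here refl)) (∑-mono xs (h ∘ there))

∑-const : (xs : List A) (c : ℕ) → ∑ xs (λ _ → c) ≡ length xs * c
∑-const []       c = refl
∑-const (x ∷ xs) c = cong (c +_) (∑-const xs c)

∑-++ : (xs ys : List A) (f : A → ℕ) → ∑ (xs ++ ys) f ≡ ∑ xs f + ∑ ys f
∑-++ []       ys f = refl
∑-++ (x ∷ xs) ys f = trans (cong (f x +_) (∑-++ xs ys f)) (sym (+-assoc (f x) _ _))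

∑-map : (g : A → B) (xs : List A) (f : B → ℕ) → ∑ (map g xs) f ≡ ∑ xs (f ∘ g)
∑-map g []       f = refl
∑-map g (x ∷ xs) f = cong (f (g x) +_) (∑-map g xs f)

∑-concatMap : (g : A → List B) (xs : List A) (f : B → ℕ) → ∑ (concatMap g xs) f ≡ ∑ xs (λ x → ∑ (g x) f)
∑-concatMap g []       f = refl
∑-concatMap g (x ∷ xs) f = trans (∑-++ (g x) _ f) (cong (∑ (g x) f +_) (∑-concatMap g xs f))

+-interchange : ∀ a b c d → (a + b) + (c + d) ≡ (a + c) + (b + d)
+-interchange a b c d = begin
  (a + b) + (c + d) ≡⟨ +-assoc a b _ ⟩
  a + (b + (c + d)) ≡⟨ cong (a +_) (sym (+-assoc b c d)) ⟩
  a + (b + c + d)   ≡⟨ cong (λ h → a + (h + d)) (+-comm b c) ⟩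
  a + (c + b + d)   ≡⟨ cong (a +_) (+-assoc c b d) ⟩
  a + (c + (b + d)) ≡⟨ sym (+-assoc a c _) ⟩
  (a + c) + (b + d) ∎
  where open ≡-Reasoning

∑-+ : (xs : List A) (f g : A → ℕ) → ∑ xs (λ x → f x + g x) ≡ ∑ xs f + ∑ xs g
∑-+ []       f g = refl
∑-+ (x ∷ xs) f g = trans (cong (f x + g x +_) (∑-+ xs f g)) (+-interchange (f x) (g x) _ _)

∑-swap : (xs : List A) (ys : List B) (f : A → B → ℕ) →
         ∑ xs (λ x → ∑ ys (f x)) ≡ ∑ ys (λ y → ∑ xs (λ x → f x y))
∑-swap []       ys f = sym (trans (∑-const ys 0) (*-zeroʳ (length ys)))
∑-swap (x ∷ xs) ys f = trans (cong (∑ ys (f x) +_) (∑-swap xs ys f)) (sym (∑-+ ys (f x) _))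

∑-*ˡ : (c : ℕ) (xs : List A) (f : A → ℕ) → c * ∑ xs f ≡ ∑ xs (λ x → c * f x)
∑-*ˡ c []       f = *-zeroʳ c
∑-*ˡ c (x ∷ xs) f = trans (*-distribˡ-+ c (f x) _) (cong (c * f x +_) (∑-*ˡ c xs f))

∑-∈ : {xs : List A} {x : A} (f : A → ℕ) → x ∈ xs → f x ≤ ∑ xs f
∑-∈ f (here refl) = m≤m+n _ _
∑-∈ {xs = y ∷ _} f (there x∈) = ≤-trans (∑-∈ f x∈) (m≤n+m _ (f y))

∑-pigeon : (x : A) (xs : List A) (f : A → ℕ) (c : ℕ) → suc (length xs) * c ≤ ∑ (x ∷ xs) f →
           ∃ λ y → y ∈ x ∷ xs × c ≤ f y
∑-pigeon x [] f c le = x , here refl , subst₂ _≤_ (+-identityʳ c) (+-identityʳ (f x)) le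
∑-pigeon x (x′ ∷ xs) f c le with c ≤? f x
... | yes c≤ = x , here refl , c≤
... | no c≰ =
  let y , y∈ , c≤ = ∑-pigeon x′ xs f c
        (+-cancelˡ-≤ c _ _ (≤-trans le (+-monoˡ-≤ (∑ (x′ ∷ xs) f) (<⇒≤ (≰⇒> c≰)))))
  in y , there y∈ , c≤

♯≤length : (p : A → Bool) (xs : List A) → ♯ p xs ≤ length xs
♯≤length p []       = z≤n
♯≤length p (x ∷ xs) with p x
... | true  = s≤s (♯≤length p xs)
... | false = m≤n⇒m≤1+n (♯≤length p xs)

ind-mono : ∀ {a b} → (a ≡ true → b ≡ true) → ind a ≤ ind b
ind-mono {false} h = z≤n
ind-mono {true}  h = ≤-reflexive (cong ind (sym (h refl)))

♯-mono : {p q : A → Bool} (xs : List A) → (∀ {x} → x ∈ xs → p x ≡ true → q x ≡ true) → ♯ p xs ≤ ♯ q xs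
♯-mono xs h = ∑-mono xs (ind-mono ∘ h)

♯-strict : {p q : A → Bool} {xs : List A} {x : A} → (∀ x → p x ≡ true → q x ≡ true) →
           x ∈ xs → p x ≡ false → q x ≡ true → ♯ p xs < ♯ q xs
♯-strict {q = q} {xs = x ∷ xs} h (here refl) e₁ e₂ rewrite e₁ | e₂ = s≤s (♯-mono xs (λ {y} _ → h y))
♯-strict {xs = y ∷ xs} h (there x∈) e₁ e₂ =
  +-mono-≤-< (ind-mono (h y)) (♯-strict h x∈ e₁ e₂)

♯-positive : (p : A → Bool) {xs : List A} {x : A} → x ∈ xs → p x ≡ true → 0 < ♯ p xs
♯-positive p x∈ px = ≤-trans (≤-reflexive (cong ind (sym px))) (∑-∈ (ind ∘ p) x∈)

∈-remove : {xs : List A} {x : A} → x ∈ xs → ∃ λ ys → length xs ≡ suc (length ys) × (∀ {y} → y ∈ xs → y ≢ x → y ∈ ys)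
∈-remove {xs = _ ∷ ys} (here refl) = ys , refl , λ { (here e) ne → contradiction e ne ; (there y∈) _ → y∈ }
∈-remove {xs = z ∷ _} (there x∈) with ys , e , h ← ∈-remove x∈ =
  z ∷ ys , cong suc e , λ { (here e) _ → here e ; (there y∈) ne → there (h y∈ ne) }

Unique-⊆-length : {xs ys : List A} → Unique xs → (∀ {x} → x ∈ xs → x ∈ ys) → length xs ≤ length ys
Unique-⊆-length [] h = z≤n
Unique-⊆-length {xs = x ∷ xs} (x≢ ∷ u) h with zs , e , g ← ∈-remove (h (here refl)) =
  ≤-trans (s≤s (Unique-⊆-length u (λ y∈ → g (h (there y∈)) (λ eq → All.lookup x≢ y∈ (sym eq)))))
          (≤-reflexive (sym e))

-- Each entry of `F` kills at most one candidate, so striking out its victims shortens the list by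
-- at most one. The greedy choices of new vertices and colours below all rest on this.
avoid : {Kill : A → B → Set} → (∀ x y → Dec (Kill x y)) →
        (xs : List A) → Unique xs → (F : List B) →
        (∀ {x x′ y} → x ∈ xs → x′ ∈ xs → Kill x y → Kill x′ y → x ≡ x′) →
        length F < length xs → ∃ λ x → x ∈ xs × (∀ {y} → y ∈ F → ¬ Kill x y)
avoid K? (x ∷ xs) u [] inj lt = x , here refl , λ ()
avoid {A = A} {Kill = Kill} K? xs u (y ∷ F) inj lt
  = let x , x∈ , ok = avoid K? (select keep xs) (select-Unique keep u) F
          (λ a b → inj (proj₁ (∈-select⁻ keep xs a)) (proj₁ (∈-select⁻ keep xs b)))
          (s≤s⁻¹ (≤-trans lt (shrink xs u inj)))
        x∈xs , kx = ∈-select⁻ keep xs x∈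
    in x , x∈xs , λ { (here refl) → does⇒ (¬? (K? x y)) kx ; (there e) → ok e }
  where
  keep : A → Bool
  keep z = does (¬? (K? z y))
  none : ∀ {z} zs → Kill z y → All (z ≢_) zs → (∀ {x x′ y} → x ∈ (z ∷ zs) → x′ ∈ (z ∷ zs) → Kill x y → Kill x′ y → x ≡ x′) →
         length zs ≤ length (select keep zs)
  none [] k a i = z≤n
  none (w ∷ zs) k (z≢w ∷ a) i with K? w y
  ... | yes k′ = contradiction (i (here refl) (there (here refl)) k k′) z≢w
  ... | no _   = s≤s (none zs k a (λ a b → i (up a) (up b)))
    where up : ∀ {x z} → x ∈ (z ∷ zs) → x ∈ (z ∷ w ∷ zs)
          up (here e)  = here e
          up (there e) = there (there e)
  shrink : ∀ zs → Unique zs → (∀ {x x′ y} → x ∈ zs → x′ ∈ zs → Kill x y → Kill x′ y → x ≡ x′) →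
           length zs ≤ suc (length (select keep zs))
  shrink [] _ _ = z≤n
  shrink (z ∷ zs) (a ∷ u) i with K? z y
  ... | yes k = s≤s (none zs k a i)
  ... | no _  = s≤s (shrink zs u (λ a b → i (there a) (there b)))

-- Tuples in a box

Rel : ℕ → Set
Rel s = Vec ℕ s → Bool

vecs : ℕ → (s : ℕ) → List (Vec ℕ s)
vecs N zero    = [] ∷ []
vecs N (suc s) = concatMap (λ t → map (_∷ t) (upTo N)) (vecs N s)

∈-concatMap : {f : A → List B} {x : A} {xs : List A} {y : B} → x ∈ xs → y ∈ f x → y ∈ concatMap f xs
∈-concatMap {f = f} (here refl) y∈ = ∈-++⁺ˡ y∈
∈-concatMap {f = f} {xs = z ∷ _} (there x∈) y∈ = ∈-++⁺ʳ (f z) (∈-concatMap x∈ y∈)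

∈-vecs⁺ : ∀ {N} {v : Vec ℕ s} → VAll (_< N) v → v ∈ vecs N s
∈-vecs⁺ [] = here refl
∈-vecs⁺ {v = x ∷ v} (x< ∷ a) = ∈-concatMap (∈-vecs⁺ a) (∈-map⁺ (_∷ v) (∈-upTo⁺ x<))

∈-vecs⁻ : ∀ {N} {v : Vec ℕ s} → v ∈ vecs N s → VAll (_< N) v
∈-vecs⁻ {zero} {v = []} _ = []
∈-vecs⁻ {suc s} {N} {v} v∈ = go (vecs N s) (λ t∈ → ∈-vecs⁻ t∈) v∈
  where
  go : ∀ ts → (∀ {t} → t ∈ ts → VAll (_< N) t) → v ∈ concatMap (λ t → map (_∷ t) (upTo N)) ts → VAll (_< N) v
  go (t ∷ ts) h v∈ with ∈-++⁻ (map (_∷ t) (upTo N)) v∈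
  ... | inj₂ v∈′ = go ts (h ∘ there) v∈′
  ... | inj₁ v∈′ with x , x∈ , refl ← ∈-map⁻ (_∷ t) v∈′ = ∈-upTo⁻ x∈ ∷ h (here refl)

∑-vecs-suc : ∀ N s (f : Vec ℕ (suc s) → ℕ) → ∑ (vecs N (suc s)) f ≡ ∑ (vecs N s) (λ t → ∑ (upTo N) (λ z → f (z ∷ t)))
∑-vecs-suc N s f = trans (∑-concatMap _ (vecs N s) f) (∑-cong (vecs N s) (λ t → ∑-map (_∷ t) (upTo N) f))

length≡∑ : (xs : List A) → length xs ≡ ∑ xs (λ _ → 1)
length≡∑ xs = sym (trans (∑-const xs 1) (*-identityʳ _))

length-vecs : ∀ N s → length (vecs N s) ≡ N ^ s
length-vecs N zero    = refl
length-vecs N (suc s) = begin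
  length (vecs N (suc s))                          ≡⟨ length≡∑ (vecs N (suc s)) ⟩
  ∑ (vecs N (suc s)) (λ _ → 1)                     ≡⟨ ∑-vecs-suc N s _ ⟩
  ∑ (vecs N s) (λ t → ∑ (upTo N) (λ z → 1))        ≡⟨ ∑-cong (vecs N s) (λ _ → trans (sym (length≡∑ (upTo N))) (length-upTo N)) ⟩
  ∑ (vecs N s) (λ t → N)                           ≡⟨ ∑-const (vecs N s) N ⟩
  length (vecs N s) * N                            ≡⟨ cong (_* N) (length-vecs N s) ⟩
  N ^ s * N                                        ≡⟨ *-comm (N ^ s) N ⟩
  N ^ suc s                                        ∎
  where open ≡-Reasoning

∑-insertAt : ∀ N s (j : Fin (suc s)) (f : Vec ℕ (suc s) → ℕ) →
             ∑ (vecs N (suc s)) f ≡ ∑ (vecs N s) (λ t → ∑ (upTo N) (λ z → f (insertAt t j z)))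
∑-insertAt N zero    zero f = ∑-vecs-suc N zero f
∑-insertAt N (suc s) zero f = ∑-vecs-suc N (suc s) f
∑-insertAt N (suc s) (suc j) f = begin
  ∑ (vecs N (suc (suc s))) f
    ≡⟨ ∑-vecs-suc N (suc s) f ⟩
  ∑ (vecs N (suc s)) (λ t → ∑ (upTo N) (λ z → f (z ∷ t)))
    ≡⟨ ∑-insertAt N s j _ ⟩
  ∑ (vecs N s) (λ t → ∑ (upTo N) (λ y → ∑ (upTo N) (λ z → f (z ∷ insertAt t j y))))
    ≡⟨ ∑-cong (vecs N s) (λ t → ∑-swap (upTo N) (upTo N) _) ⟩
  ∑ (vecs N s) (λ t → ∑ (upTo N) (λ z → ∑ (upTo N) (λ y → f (z ∷ insertAt t j y))))
    ≡⟨ ∑-vecs-suc N s _ ⟨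
  ∑ (vecs N (suc s)) (λ t → ∑ (upTo N) (λ y → f (insertAt t (suc j) y))) ∎
  where open ≡-Reasoning

-- Edges as vertex lists, and linear cycles as closed chains

Unique-resp-↭ : {xs ys : List A} → xs ↭ ys → Unique xs → Unique ys
Unique-resp-↭ Perm.refl u = u
Unique-resp-↭ (Perm.prep x p) (a ∷ u) = All-resp-↭ p a ∷ Unique-resp-↭ p u
Unique-resp-↭ (Perm.swap x y p) ((x≢y ∷ a) ∷ b ∷ u) =
  ((x≢y ∘ sym) ∷ All-resp-↭ p b) ∷ All-resp-↭ p a ∷ Unique-resp-↭ p u
Unique-resp-↭ (Perm.trans p q) u = Unique-resp-↭ q (Unique-resp-↭ p u)

toSet : (n : ℕ) → List ℕ → Subset n
toSet n l = tabulate (λ i → does (toℕ i ∈? l))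

∈-toSet⁻ : ∀ {l} {i : Fin n} → i ∈ₛ toSet n l → toℕ i ∈ l
∈-toSet⁻ {l = l} {i} i∈ =
  does⇒ (toℕ i ∈? l) (trans (sym (lookup∘tabulate _ i)) ([]=⇒lookup i∈))

∈-toSet⁺ : ∀ {l} {i : Fin n} → toℕ i ∈ l → i ∈ₛ toSet n l
∈-toSet⁺ {l = l} {i} i∈ =
  lookup⇒[]= i _ (trans (lookup∘tabulate _ i) (dec-true (toℕ i ∈? l) i∈))

toSet-cong : ∀ {l l′} → (∀ {x} → x ∈ l → x ∈ l′) → (∀ {x} → x ∈ l′ → x ∈ l) → toSet n l ≡ toSet n l′
toSet-cong {l = l} {l′} f g = tabulate-cong λ i → bool-ext
  (λ e → dec-true (toℕ i ∈? l′) (f (does⇒ (toℕ i ∈? l) e)))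
  (λ e → dec-true (toℕ i ∈? l) (g (does⇒ (toℕ i ∈? l′) e)))

record IsEdge (H : RGraph r n) (l : List ℕ) : Set where
  constructor isEdge
  field
    distinct : Unique l
    inRange  : All (_< n) l
    present  : edge H (toSet n l) ≡ true
open IsEdge public

isEdge? : (H : RGraph r n) (l : List ℕ) → Dec (IsEdge H l)
isEdge? {n = n} H l with unique? l | all? (_<? n) l | edge H (toSet n l) Boolₚ.≟ true
... | yes a | yes b | yes c = yes (isEdge a b c)
... | no ¬a | _     | _     = no (¬a ∘ distinct)
... | yes _ | no ¬b | _     = no (¬b ∘ inRange)
... | yes _ | yes _ | no ¬c = no (¬c ∘ present)

IsEdge-resp-↭ : (H : RGraph r n) {l l′ : List ℕ} → l ↭ l′ → IsEdge H l → IsEdge H l′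
IsEdge-resp-↭ H p (isEdge u a e) = isEdge (Unique-resp-↭ p u) (All-resp-↭ p a)
  (trans (cong (edge H) (toSet-cong (∈-resp-↭ (↭-sym p)) (∈-resp-↭ p))) e)

-- A block lists the first vertex of an edge followed by its private vertices;
-- the edge is completed by the first vertex of the next block.
data Chain (E : List ℕ → Set) {m : ℕ} : ℕ → ℕ → ∀ {k} → Vec (Vec ℕ (suc m)) k → Set where
  last : ∀ {x y P} → E (y ∷ x ∷ toList P) → Chain E x y ((x ∷ P) ∷ [])
  step : ∀ {x y p P k} {bs : Vec (Vec ℕ (suc m)) k} →
         E (p ∷ x ∷ toList P) → Chain E p y bs → Chain E x y ((x ∷ P) ∷ bs)

_⟫_ : ∀ {E k k′ x y z} {bs : Vec (Vec ℕ (suc m)) k} {cs : Vec (Vec ℕ (suc m)) k′} →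
      Chain E x y bs → Chain E y z cs → Chain E x z (bs Vec.++ cs)
last e   ⟫ d = step e d
step e c ⟫ d = step e (c ⟫ d)

next : Vec (Vec ℕ (suc m)) k → ℕ → Fin k → ℕ
next (b ∷ [])      y zero    = y
next (b ∷ b′ ∷ bs) y zero    = head b′
next (b ∷ bs)      y (suc i) = next bs y i

chain-head : ∀ {E x y} {b : Vec ℕ (suc m)} {bs : Vec (Vec ℕ (suc m)) k} → Chain E x y (b ∷ bs) → head b ≡ x
chain-head (last _)   = refl
chain-head (step _ _) = refl

chain-edge : ∀ {E x y} {bs : Vec (Vec ℕ (suc m)) k} → Chain E x y bs →
             ∀ i → E (next bs y i ∷ toList (lookup bs i))
chain-edge (last e) zero = e
chain-edge {E = E} (step {x = x} {P = P} {bs = _ ∷ _} e c) zero =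
  subst (λ p → E (p ∷ x ∷ toList P)) (sym (chain-head c)) e
chain-edge (step {bs = _ ∷ _} e c) (suc i) = chain-edge c i

chain-first : ∀ {E x y} {bs : Vec (Vec ℕ (suc m)) k} → Chain E x y bs →
              ∃ λ (j : Fin (k * suc m)) → toℕ j ≡ 0 × lookup (concat bs) j ≡ x
chain-first (last _)   = zero , refl , refl
chain-first (step _ _) = zero , refl , refl

next-cases : ∀ (bs : Vec (Vec ℕ (suc m)) k) y i →
             (∃ λ i′ → toℕ i′ ≡ suc (toℕ i) × next bs y i ≡ head (lookup bs i′)) ⊎ (suc (toℕ i) ≡ k × next bs y i ≡ y)
next-cases (b ∷ [])      y zero = inj₂ (refl , refl)
next-cases (b ∷ b′ ∷ bs) y zero = inj₁ (suc zero , refl , refl)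
next-cases (b ∷ b′ ∷ bs) y (suc i) with next-cases (b′ ∷ bs) y i
... | inj₁ (i′ , e , f) = inj₁ (suc i′ , cong suc e , f)
... | inj₂ (e , f)      = inj₂ (cong suc e , f)

lookup∈toList : ∀ {n} (v : Vec ℕ n) i → lookup v i ∈ toList v
lookup∈toList (x ∷ v) zero    = here refl
lookup∈toList (x ∷ v) (suc i) = there (lookup∈toList v i)

toList∈lookup : ∀ {n} (v : Vec ℕ n) {u} → u ∈ toList v → ∃ λ i → lookup v i ≡ u
toList∈lookup (x ∷ v) (here refl) = zero , refl
toList∈lookup (x ∷ v) (there u∈)  = let i , e = toList∈lookup v u∈ in suc i , e

lookup-unique : ∀ {n} (v : Vec ℕ n) → Unique (toList v) → ∀ i j → lookup v i ≡ lookup v j → i ≡ j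
lookup-unique (x ∷ v) _       zero    zero    e = refl
lookup-unique (x ∷ v) (a ∷ _) zero    (suc j) e = contradiction e (All.lookup a (lookup∈toList v j))
lookup-unique (x ∷ v) (a ∷ _) (suc i) zero    e = contradiction (sym e) (All.lookup a (lookup∈toList v i))
lookup-unique (x ∷ v) (_ ∷ u) (suc i) (suc j) e = cong suc (lookup-unique v u i j e)

module _ (H : RGraph (2 + m) n) where

  -- Entry `t` of block `i` sits at position `i * suc m + t`. The remaining vertex of edge `i`, at
  -- offset `suc m`, is the first vertex of block `i + 1`; for the last block it wraps round to
  -- position 0, which holds `x` because the chain also starts there.
  cycle⇒ContainsCycle : ∀ {x} {bs : Vec (Vec ℕ (suc m)) k} → Chain (IsEdge H) x x bs →
                        Unique (toList (concat bs)) → ContainsCycle (2 + m) k H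
  cycle⇒ContainsCycle {k = k} {x} {bs} c u = φ , φ-inj , λ i →
    toSet n (es i) , present (chain-edge c i) , fwd i , bwd i
    where
    es : Fin k → List ℕ
    es i = next bs x i ∷ toList (lookup bs i)
    at : Fin (k * suc m) → ℕ
    at j = lookup (concat bs) j
    at-combine : ∀ i t → at (combine i t) ≡ lookup (lookup bs i) t
    at-combine i t = lookup-concat bs i t
    at< : ∀ j → at j < n
    at< j = let i , t = remQuot {k} (suc m) j in
      subst (_< n) (trans (sym (at-combine i t)) (cong at (combine-remQuot {k} (suc m) j)))
        (All.lookup (inRange (chain-edge c i)) (there (lookup∈toList (lookup bs i) t)))
    φ : Fin (k * suc m) → Fin n
    φ j = fromℕ< (at< j)
    toℕ-φ : ∀ j → toℕ (φ j) ≡ at j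
    toℕ-φ j = toℕ-fromℕ< (at< j)
    φ-inj : ∀ {i j} → φ i ≡ φ j → i ≡ j
    φ-inj {i} {j} e = lookup-unique (concat bs) u i j
      (trans (sym (toℕ-φ i)) (trans (cong toℕ e) (toℕ-φ j)))
    toℕ-comb : ∀ (i : Fin k) (t : Fin (suc m)) → toℕ (combine i t) ≡ toℕ i * suc m + toℕ t
    toℕ-comb i t = trans (toℕ-combine i t) (cong (_+ toℕ t) (*-comm (suc m) (toℕ i)))
    topFin : ∃ λ (t : Fin (2 + m)) → toℕ t ≡ suc m
    topFin = fromℕ< {suc m} ≤-refl , toℕ-fromℕ< {suc m} ≤-refl
    inj₁F : ∀ (t : Fin (suc m)) → ∃ λ (t′ : Fin (2 + m)) → toℕ t′ ≡ toℕ t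
    inj₁F t = fromℕ< (m<n⇒m<1+n (toℕ<n t)) , toℕ-fromℕ< _
    wrap : ∀ i → i * suc m + suc m ≡ suc i * suc m + 0
    wrap i = trans (+-comm (i * suc m) (suc m)) (sym (+-identityʳ (suc i * suc m)))
    head≡ : (b : Vec ℕ (suc m)) → head b ≡ lookup b zero
    head≡ (_ ∷ _) = refl
    nextPos : ∀ i → ∃ λ j → at j ≡ next bs x i ×
                (toℕ i * suc m + suc m ≡ toℕ j ⊎ toℕ i * suc m + suc m ≡ toℕ j + k * suc m)
    nextPos i with next-cases bs x i
    ... | inj₁ (i′ , e , f) = combine i′ zero ,
          trans (at-combine i′ zero) (sym (trans f (head≡ (lookup bs i′)))) ,
          inj₁ (trans (wrap (toℕ i)) (trans (cong (λ h → h * suc m + 0) (sym e)) (sym (toℕ-comb i′ zero))))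
    ... | inj₂ (e , f) = let j , j0 , a = chain-first c in
          j , trans a (sym f) ,
          inj₂ (trans (wrap (toℕ i)) (trans (+-identityʳ _) (trans (cong (_* suc m) e) (cong (_+ k * suc m) (sym j0)))))
    fwd : ∀ i v → v ∈ₛ toSet n (es i) → ∃ λ j → CycEdge (2 + m) k i j × φ j ≡ v
    fwd i v v∈ with ∈-toSet⁻ {l = es i} v∈
    ... | here e = let j , a , b = nextPos i ; t , te = topFin in
          j , (t , subst (λ h → toℕ i * suc m + h ≡ toℕ j ⊎ toℕ i * suc m + h ≡ toℕ j + k * suc m) (sym te) b) ,
          toℕ-injective (trans (toℕ-φ j) (trans a (sym e)))
    ... | there v∈′ = let t , e = toList∈lookup (lookup bs i) v∈′ ; t′ , te = inj₁F t in
          combine i t , (t′ , inj₁ (trans (cong (toℕ i * suc m +_) te) (sym (toℕ-comb i t)))) ,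
          toℕ-injective (trans (toℕ-φ _) (trans (at-combine i t) e))
    bwd : ∀ i j → CycEdge (2 + m) k i j → φ j ∈ₛ toSet n (es i)
    bwd i j ce = ∈-toSet⁺ (subst (_∈ es i) (sym (toℕ-φ j)) (go ce))
      where
      go : CycEdge (2 + m) k i j → at j ∈ es i
      go (t , eq) with toℕ t <? suc m
      go (t , inj₁ eq) | yes t< = there (subst (_∈ toList (lookup bs i))
          (trans (sym (at-combine i (fromℕ< t<))) (cong at (toℕ-injective
             (trans (toℕ-comb i (fromℕ< t<)) (trans (cong (toℕ i * suc m +_) (toℕ-fromℕ< t<)) eq)))))
          (lookup∈toList (lookup bs i) (fromℕ< t<)))
      -- Only the last vertex of an edge can wrap round: an entry inside a block lies below
      -- `k * suc m`.
      go (t , inj₂ eq) | yes t< = contradiction eq (<⇒≢ (≤-trans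
          (+-monoʳ-< (toℕ i * suc m) t<)
          (≤-trans (≤-reflexive (+-comm (toℕ i * suc m) (suc m)))
            (≤-trans (*-monoˡ-≤ (suc m) (toℕ<n i)) (m≤n+m _ (toℕ j))))))
      go (t , eq) | no t≮ with t≡ ← ≤-antisym (s≤s⁻¹ (toℕ<n t)) (≮⇒≥ t≮) | nextPos i
      ... | j′ , a , b = here (trans (cong at (toℕ-injective (same eq b))) a)
        where
        same : (toℕ i * suc m + toℕ t ≡ toℕ j) ⊎ (toℕ i * suc m + toℕ t ≡ toℕ j + k * suc m) →
               (toℕ i * suc m + suc m ≡ toℕ j′) ⊎ (toℕ i * suc m + suc m ≡ toℕ j′ + k * suc m) → toℕ j ≡ toℕ j′
        same p q rewrite t≡ with p | q
        ... | inj₁ p | inj₁ q = trans (sym p) q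
        ... | inj₁ p | inj₂ q = contradiction (toℕ<n j) (≤⇒≯ (≤-trans (m≤n+m _ (toℕ j′)) (≤-reflexive (trans (sym q) p))))
        ... | inj₂ p | inj₁ q = contradiction (toℕ<n j′) (≤⇒≯ (≤-trans (m≤n+m _ (toℕ j)) (≤-reflexive (trans (sym p) q))))
        ... | inj₂ p | inj₂ q = +-cancelʳ-≡ (k * suc m) _ _ (trans (sym p) q)

-- Linear cycles in relations of large codegree

Full : ∀ {s} → ℕ → ℕ → Rel s → Set
Full {s} m d P = ∀ e → P e ≡ true → (j : Fin s) → d ≤ ♯ (λ z → P (e [ j ]≔ z)) (upTo m)

toList-concat : ∀ {m k} (b : Vec ℕ m) (bs : Vec (Vec ℕ m) k) → toList (concat (b ∷ bs)) ≡ toList b ++ toList (concat bs)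
toList-concat b bs = toList-++ b (concat bs)

length-toList : ∀ {n} (v : Vec A n) → length (toList v) ≡ n
length-toList []      = refl
length-toList (x ∷ v) = cong suc (length-toList v)

tailSlots : ∀ s → Vec (Fin (3 + s)) s
tailSlots s = tabulate (λ i → suc (suc (suc i)))

slots : ∀ s → List (Fin (3 + s))
slots s = zero ∷ suc zero ∷ suc (suc zero) ∷ toList (tailSlots s)

∈-tabulate : ∀ {n} (g : Fin n → A) {x} → x ∈ toList (tabulate g) → ∃ λ i → x ≡ g i
∈-tabulate {n = suc n} g (here e)   = zero , e
∈-tabulate {n = suc n} g (there x∈) = let i , e = ∈-tabulate (g ∘ suc) x∈ in suc i , e

tabulate-Unique : ∀ {n} (g : Fin n → A) → (∀ {i j} → g i ≡ g j → i ≡ j) → Unique (toList (tabulate g))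
tabulate-Unique {n = zero}  g inj = []
tabulate-Unique {n = suc n} g inj =
  All.tabulate (λ x∈ e → let i , e′ = ∈-tabulate (g ∘ suc) x∈ in contradiction (inj (trans e e′)) λ ())
  ∷ tabulate-Unique (g ∘ suc) (Fin-suc-injective ∘ inj)

slots-Unique : ∀ s → Unique (slots s)
slots-Unique s = tabulate-Unique {n = 3 + s} (λ i → i) (λ e → e)

-- The joints form a fan: after the first one, which stays in slot 0, they alternate
-- between slots 1 and 2; afterwards all other slots are replaced by unused vertices.
-- `ext` attaches further vertices (below: a colour) to each tuple.
module FullCycle
  {s x q m d : ℕ} (P : Rel (3 + s)) (full : Full m d P)
  (f : Fin (3 + s) → ℕ → ℕ) (f-inj : ∀ j {a b} → f j a ≡ f j b → a ≡ b)
  (ext : Vec ℕ (3 + s) → Vec ℕ x)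
  (ext-inj : ∀ {e e′ u} → P e ≡ true → P e′ ≡ true → u ∈ toList (ext e) → u ∈ toList (ext e′) → e ≡ e′)
  (E : List ℕ → Set) (E-resp : ∀ {l l′} → l ↭ l′ → E l → E l′) (E-unique : ∀ {l} → E l → Unique l)
  (P-edge : ∀ {e} → P e ≡ true → E (map (λ j → f j (lookup e j)) (slots s) ++ toList (ext e)))
  (large : (3 + q) * (2 + (s + x)) + (3 + q) * (2 + (s + x)) < d)
  where

  -- A forbidden vertex excludes at most one `z` as the new vertex, and at most one through the
  -- attached vertices, since distinct tuples have disjoint extensions. Hence twice the length of
  -- `F` is compared with `d`.
  pick : ∀ {e} → P e ≡ true → ∀ j F → length F + length F < d →
         ∃ λ z → P (e [ j ]≔ z) ≡ true × f j z ∉ F × (∀ {u} → u ∈ toList (ext (e [ j ]≔ z)) → u ∉ F)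
  pick {e} Pe j F F< =
    let z , z∈ , ok = avoid Kill? zs (select-Unique p (Uniqueₚ.upTo⁺ m)) FF inj
          (<-≤-trans (subst (_< d) (sym len) F<) (≤-trans (full e Pe j) (≤-reflexive (sym (length-select p (upTo m))))))
        _ , Pz = ∈-select⁻ p (upTo m) z∈
    in z , Pz , (λ fz∈ → ok (∈-++⁺ˡ (∈-map⁺ inj₁ fz∈)) refl) ,
       λ u∈ u∈F → ok (∈-++⁺ʳ (map inj₁ F) (∈-map⁺ inj₂ u∈F)) u∈
    where
    p : ℕ → Bool
    p z = P (e [ j ]≔ z)
    zs = select p (upTo m)
    Kill : ℕ → ℕ ⊎ ℕ → Set
    Kill z (inj₁ u) = f j z ≡ u
    Kill z (inj₂ u) = u ∈ toList (ext (e [ j ]≔ z))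
    Kill? : ∀ z u → Dec (Kill z u)
    Kill? z (inj₁ u) = f j z ≟ u
    Kill? z (inj₂ u) = u ∈? toList (ext (e [ j ]≔ z))
    FF = map inj₁ F ++ map inj₂ F
    len : length FF ≡ length F + length F
    len = trans (length-++ (map inj₁ F)) (cong₂ _+_ (length-map inj₁ F) (length-map inj₂ F))
    inj : ∀ {z z′ u} → z ∈ zs → z′ ∈ zs → Kill z u → Kill z′ u → z ≡ z′
    inj {u = inj₁ u} _ _ a b = f-inj j (trans a (sym b))
    inj {z} {z′} {inj₂ u} z∈ z′∈ a b =
      trans (sym (lookup∘update j e z)) (trans (cong (λ h → lookup h j)
        (ext-inj (proj₂ (∈-select⁻ p (upTo m) z∈)) (proj₂ (∈-select⁻ p (upTo m) z′∈)) a b)) (lookup∘update j e z′))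

  refresh : ∀ F → length F + length F < d → ∀ {e} → P e ≡ true → ∀ js → Unique js →
            ∃ λ e′ → P e′ ≡ true × (∀ j → j ∉ js → lookup e′ j ≡ lookup e j) × (∀ {j} → j ∈ js → f j (lookup e′ j) ∉ F)
  refresh F F< {e} Pe [] _ = e , Pe , (λ _ _ → refl) , λ ()
  refresh F F< {e} Pe (j ∷ js) (j≢ ∷ u) =
    let e₁ , Pe₁ , same , new = refresh F F< Pe js u
        z , Pz , fz , _ = pick Pe₁ j F F<
    in e₁ [ j ]≔ z , Pz ,
       (λ i i∉ → trans (lookup∘update′ (i∉ ∘ here) e₁ z) (same i (i∉ ∘ there))) ,
       λ { (here refl) → subst (λ h → f j h ∉ F) (sym (lookup∘update j e₁ z)) fz
         ; {i} (there i∈) → subst (λ h → f i h ∉ F)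
             (sym (lookup∘update′ (λ { refl → All.lookup j≢ i∈ refl }) e₁ z)) (new i∈) }

  vertex : Vec ℕ (3 + s) → Fin (3 + s) → ℕ
  vertex e j = f j (lookup e j)

  private
    c = 2 + (s + x)

  Private : Set
  Private = Vec ℕ (suc (s + x))

  others : Fin (3 + s) → Vec ℕ (3 + s) → Private
  others ρ e = vertex e ρ ∷ (Vec.map (vertex e) (tailSlots s) Vec.++ ext e)

  module _ {σ τ ρ} (perm : σ ∷ τ ∷ ρ ∷ toList (tailSlots s) ↭ slots s) where

    others-edge : ∀ {e} → P e ≡ true → E (vertex e τ ∷ vertex e σ ∷ toList (others ρ e))
    others-edge {e} Pe = E-resp (Perm.swap _ _ ↭-refl) (subst (λ h → E (vertex e σ ∷ vertex e τ ∷ vertex e ρ ∷ h)) eq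
        (E-resp (++⁺ʳ (toList (ext e)) (↭-map⁺ (vertex e) (↭-sym perm))) (P-edge Pe)))
      where
      eq : map (vertex e) (toList (tailSlots s)) ++ toList (ext e) ≡ toList (Vec.map (vertex e) (tailSlots s) Vec.++ ext e)
      eq = sym (trans (toList-++ (Vec.map (vertex e) (tailSlots s)) (ext e))
                      (cong (_++ toList (ext e)) (toList-map (vertex e) (tailSlots s))))

    freshen : ∀ F → length F + length F < d → ∀ {e} → P e ≡ true →
              ∃ λ (b : Private) → E (vertex e τ ∷ vertex e σ ∷ toList b) × (∀ {u} → u ∈ toList b → u ∉ F)
    freshen F F< {e} Pe with σ≢ ∷ τ≢ ∷ ρ≢ ∷ u ← Unique-resp-↭ (↭-sym perm) (slots-Unique s) =
      let ts = toList (tailSlots s)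
          e₁ , Pe₁ , same , new = refresh F F< Pe ts u
          -- Slot `ρ` is replaced last: the attached vertices change with every replacement, and
          -- only those of the final tuple must avoid `F`.
          z , Pz , fz , extz = pick Pe₁ ρ F F<
          e₂ = e₁ [ ρ ]≔ z
          keep : ∀ {i} → i ≢ ρ → i ∉ ts → vertex e₂ i ≡ vertex e i
          keep i≢ i∉ = cong (f _) (trans (lookup∘update′ i≢ e₁ z) (same _ i∉))
          fresh : ∀ {u} → u ∈ toList (others ρ e₂) → u ∉ F
          fresh = λ { (here refl) → subst (λ h → f ρ h ∉ F) (sym (lookup∘update ρ e₁ z)) fz
                    ; {u} (there u∈) → [ (λ u∈ → let i , i∈ , eq = ∈-map⁻ (vertex e₂) (subst (u ∈_) (toList-map (vertex e₂) (tailSlots s)) u∈) in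
                                       subst (_∉ F) (sym (trans eq (cong (f i) (lookup∘update′ (λ e → All.lookup ρ≢ i∈ (sym e)) e₁ z)))) (new i∈))
                                   , extz ]′ (∈-++⁻ (toList (Vec.map (vertex e₂) (tailSlots s)))
                                       (subst (u ∈_) (toList-++ (Vec.map (vertex e₂) (tailSlots s)) (ext e₂)) u∈)) }
      in others ρ e₂ ,
         subst₂ (λ a b → E (a ∷ b ∷ toList (others ρ e₂)))
           (keep (All.lookup τ≢ (here refl)) (λ τ∈ → All.lookup τ≢ (there τ∈) refl))
           (keep (All.lookup σ≢ (there (here refl))) (λ σ∈ → All.lookup σ≢ (there (there σ∈)) refl))
           (others-edge Pz) ,
         fresh

  small : ∀ {a b} → a ≤ b → b ≤ (3 + q) * c → a + a < d
  small a≤b b≤ = ≤-<-trans (+-mono-≤ (≤-trans a≤b b≤) (≤-trans a≤b b≤)) large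

  -- The tuple `e` holds both the first joint (slot 0) and the current joint (slot `σ`), so the fan
  -- can be closed from it after any number of edges. The path has `suc k` of them.
  ClosingPath : ℕ → Vec ℕ (3 + s) → Fin (3 + s) → List ℕ → Set
  ClosingPath k e σ F =
    ∃ λ (bs : Vec (Vec ℕ (2 + (s + x))) (suc k)) → Chain E (vertex e σ) (vertex e zero) bs ×
      Unique (toList (concat bs)) × (∀ {u} → u ∈ toList (concat bs) → u ≡ vertex e σ ⊎ u ∉ F)

  build : ∀ k {σ τ} → zero ∷ σ ∷ τ ∷ toList (tailSlots s) ↭ slots s → ∀ {e} → P e ≡ true →
          ∀ F → vertex e zero ∈ F → vertex e σ ∈ F → length F + suc k * c ≤ (3 + q) * c →
          ClosingPath k e σ F
  build zero {σ} {τ} perm {e} Pe F x₀∈ v∈ le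
    with b , E-b , new ← freshen {σ} {zero} {τ} (↭-trans (Perm.swap _ _ ↭-refl) perm) F (small (m≤m+n (length F) _) le) Pe
    with _ ∷ u ← E-unique E-b =
    (vertex e σ ∷ b) ∷ [] , last E-b ,
    subst Unique (sym eq) u ,
    λ {u} u∈ → case (subst (u ∈_) eq u∈)
    where
    eq : toList (concat ((vertex e σ ∷ b) ∷ [])) ≡ vertex e σ ∷ toList b
    eq = trans (toList-concat (vertex e σ ∷ b) []) (++-identityʳ _)
    case : ∀ {u} → u ∈ vertex e σ ∷ toList b → u ≡ vertex e σ ⊎ u ∉ F
    case (here e)   = inj₁ e
    case (there u∈) = inj₂ (new u∈)
  build (suc k) {σ} {τ} perm {e} Pe F x₀∈ v∈ le
    with z , Pe₁ , w∉F , _ ← pick Pe τ F (small (m≤m+n (length F) _) le)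
    with (zero≢ ∷ σ≢ ∷ _) ← Unique-resp-↭ (↭-sym perm) (slots-Unique s)
    = finish
    where
    e₁ = e [ τ ]≔ z
    w = f τ z
    x₀≡ : vertex e₁ zero ≡ vertex e zero
    x₀≡ = cong (f zero) (lookup∘update′ (All.lookup zero≢ (there (here refl))) e z)
    v≡ : vertex e₁ σ ≡ vertex e σ
    v≡ = cong (f σ) (lookup∘update′ (All.lookup σ≢ (here refl)) e z)
    w≡ : vertex e₁ τ ≡ w
    w≡ = cong (f τ) (lookup∘update τ e z)
    F₁≤ : suc (length F) ≤ length F + suc (suc k) * c
    F₁≤ = ≤-trans (≤-reflexive (+-comm 1 (length F))) (+-monoʳ-≤ (length F) (s≤s z≤n))
    size : ∀ (b : Private) → length (w ∷ toList b ++ F) + suc k * c ≡ length F + suc (suc k) * c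
    size b = begin
      suc (length (toList b ++ F)) + suc k * c ≡⟨ cong (λ h → suc h + suc k * c) (trans (length-++ (toList b)) (cong (_+ length F) (length-toList b))) ⟩
      c + length F + suc k * c                 ≡⟨ cong (_+ suc k * c) (+-comm c (length F)) ⟩
      length F + c + suc k * c                 ≡⟨ +-assoc (length F) c _ ⟩
      length F + suc (suc k) * c               ∎
      where open ≡-Reasoning
    assemble : ∀ (b : Private) → E (vertex e₁ τ ∷ vertex e₁ σ ∷ toList b) → (∀ {u} → u ∈ toList b → u ∉ w ∷ F) →
               ClosingPath k e₁ τ (w ∷ toList b ++ F) → ClosingPath (suc k) e σ F
    assemble b E-b new (bs , ch , ubs , newbs) =
      (vertex e σ ∷ b) ∷ bs ,
      step E-b′ (subst₂ (λ a h → Chain E a h bs) w≡ x₀≡ ch) ,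
      subst Unique (sym (toList-concat (vertex e σ ∷ b) bs))
        (Uniqueₚ.++⁺ uvb ubs λ (p , r) → disj p r) ,
      λ {u} u∈ → case (∈-++⁻ (vertex e σ ∷ toList b) (subst (u ∈_) (toList-concat (vertex e σ ∷ b) bs) u∈))
      where
      E-b′ : E (w ∷ vertex e σ ∷ toList b)
      E-b′ = subst₂ (λ a h → E (a ∷ h ∷ toList b)) w≡ v≡ E-b
      uvb : Unique (vertex e σ ∷ toList b)
      uvb with _ ∷ u ← E-unique E-b′ = u
      disj : ∀ {u} → u ∈ vertex e σ ∷ toList b → u ∈ toList (concat bs) → ⊥
      disj p r with newbs r
      disj p r | inj₁ refl with a ∷ _ ← E-unique E-b′ = All.lookup a p (sym w≡)
      disj (here refl) r | inj₂ u∉ = u∉ (there (∈-++⁺ʳ (toList b) v∈))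
      disj (there p) r | inj₂ u∉ = u∉ (there (∈-++⁺ˡ p))
      case : ∀ {u} → u ∈ vertex e σ ∷ toList b ⊎ u ∈ toList (concat bs) → u ≡ vertex e σ ⊎ u ∉ F
      case (inj₁ (here e))   = inj₁ e
      case (inj₁ (there u∈)) = inj₂ (new u∈ ∘ there)
      case (inj₂ u∈) with newbs u∈
      ... | inj₁ refl = inj₂ (subst (_∉ F) (sym w≡) w∉F)
      ... | inj₂ u∉   = inj₂ (u∉ ∘ there ∘ ∈-++⁺ʳ (toList b))
    -- The edge between the two joints gives up the vertex in slot 0. The recursion resumes from
    -- `e₁`, which still has it, so the path can return there.
    perm₁ : σ ∷ τ ∷ zero ∷ toList (tailSlots s) ↭ slots s
    perm₁ = ↭-trans (↭-trans (Perm.prep _ (Perm.swap _ _ ↭-refl)) (Perm.swap _ _ ↭-refl)) perm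
    perm₂ : zero ∷ τ ∷ σ ∷ toList (tailSlots s) ↭ slots s
    perm₂ = ↭-trans (Perm.prep _ (Perm.swap _ _ ↭-refl)) perm
    le₂ : ∀ (b : Private) → length (w ∷ toList b ++ F) + suc k * c ≤ (3 + q) * c
    le₂ b = ≤-trans (≤-reflexive (size b)) le
    freshened : ∃ λ (b : Private) → E (vertex e₁ τ ∷ vertex e₁ σ ∷ toList b) × (∀ {u} → u ∈ toList b → u ∉ w ∷ F)
    freshened = freshen perm₁ (w ∷ F) (small F₁≤ le) Pe₁
    continue : ∀ (b : Private) → ClosingPath k e₁ τ (w ∷ toList b ++ F)
    continue b = build k perm₂ Pe₁ (w ∷ toList b ++ F)
           (subst (_∈ w ∷ toList b ++ F) (sym x₀≡) (there (∈-++⁺ʳ (toList b) x₀∈)))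
           (subst (_∈ w ∷ toList b ++ F) (sym w≡) (here refl)) (le₂ b)
    finish : ClosingPath (suc k) e σ F
    finish = let b , E-b , new = freshened in assemble b E-b new (continue b)

  cycle : ∀ {e} → P e ≡ true →
          ∃₂ λ v (bs : Vec (Vec ℕ (2 + (s + x))) (2 + q)) → Chain E v v bs × Unique (toList (concat bs))
  cycle {e} Pe = finish
    where
    v₀ = vertex e zero
    v₁ = vertex e (suc zero)
    2≤ : 2 ≤ (3 + q) * c
    2≤ = s≤s (s≤s z≤n)
    -- The first edge forbids `c + 1` vertices and each later one takes `c` from the budget; the
    -- factor `3 + q` rather than `2 + q` makes room for the extra vertex.
    size : ∀ (b : Private) → 2 + length (toList b) + suc q * c ≤ (3 + q) * c
    size b rewrite length-toList b =
      ≤-trans (+-monoˡ-≤ (suc q * c) {suc c} {c + c} (s≤s (m≤n+m c (suc (s + x)))))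
              (≤-reflexive (+-assoc c c (suc q * c)))
    disj : ∀ {b u} → All (v₁ ≢_) (v₀ ∷ toList b) → u ∈ v₀ ∷ toList b → u ≡ v₁ ⊎ u ∉ v₀ ∷ v₁ ∷ toList b → ⊥
    disj v₁≢ p (inj₁ refl) = All.lookup v₁≢ p refl
    disj _ (here refl) (inj₂ u∉) = u∉ (here refl)
    disj _ (there p) (inj₂ u∉) = u∉ (there (there p))
    assemble : ∀ (b : Private) → Unique (v₁ ∷ v₀ ∷ toList b) → E (v₁ ∷ v₀ ∷ toList b) →
               ClosingPath q e (suc zero) (v₀ ∷ v₁ ∷ toList b) →
               ∃₂ λ v (bs : Vec (Vec ℕ (2 + (s + x))) (2 + q)) → Chain E v v bs × Unique (toList (concat bs))
    assemble b (v₁≢ ∷ uvb) E-b (bs , ch , ubs , newbs) =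
      v₀ , (v₀ ∷ b) ∷ bs , step E-b ch ,
      subst Unique (sym (toList-concat (v₀ ∷ b) bs)) (Uniqueₚ.++⁺ uvb ubs λ (p , r) → disj v₁≢ p (newbs r))
    finish : ∃₂ λ v (bs : Vec (Vec ℕ (2 + (s + x))) (2 + q)) → Chain E v v bs × Unique (toList (concat bs))
    finish =
      let b , E-b , _ = freshen {zero} {suc zero} {suc (suc zero)} ↭-refl (v₀ ∷ v₁ ∷ []) (small 2≤ ≤-refl) Pe
      in assemble b (E-unique E-b) E-b
           (build q {suc zero} {suc (suc zero)} ↭-refl Pe (v₀ ∷ v₁ ∷ toList b) (here refl) (there (here refl)) (size b))

-- Peeling

∧-true : ∀ {a b} → a ∧ b ≡ true → a ≡ true × b ≡ true
∧-true {true} e = refl , e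

insertAt-update : ∀ {s} (t : Vec ℕ s) j y z → insertAt t j y [ j ]≔ z ≡ insertAt t j z
insertAt-update t       zero    y z = refl
insertAt-update (x ∷ t) (suc j) y z = cong (x ∷_) (insertAt-update t j y z)

-- Tuples are removed in rounds and assigned to their slots of codegree below d. All extensions
-- of a tuple with one slot missing leave in the same round, whence `assign-codeg`.
module Peel (m d : ℕ) where

  codeg : ∀ {s} → Rel s → Vec ℕ s → Fin s → ℕ
  codeg P v j = ♯ (λ z → P (v [ j ]≔ z)) (upTo m)

  rich? : ∀ {s} (P : Rel s) v → Dec (∀ j → d ≤ codeg P v j)
  rich? P v = Fin-all? (λ j → d ≤? codeg P v j)

  keep : ∀ {s} → Rel s → Rel s
  keep P v = P v ∧ does (rich? P v)

  assign : ∀ {s} → ℕ → Rel s → Fin s → Rel s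
  assign zero    P j v = false
  assign (suc t) P j v = if keep P v then assign t (keep P) j v else P v ∧ does (codeg P v j <? d)

  assign⊆ : ∀ {s} t (P : Rel s) j v → assign t P j v ≡ true → P v ≡ true
  assign⊆ (suc t) P j v e with keep P v in eq
  ... | true  = proj₁ (∧-true eq)
  ... | false = proj₁ (∧-true e)

  assign-codeg : ∀ {s} t (P : Rel s) j v → codeg (assign t P j) v j ≤ d
  assign-codeg zero P j v = ≤-trans (≤-reflexive (trans (∑-const (upTo m) 0) (*-zeroʳ (length (upTo m))))) z≤n
  assign-codeg (suc t) P j v with codeg P v j <? d
  ... | yes low = ≤-trans (♯-mono (upTo m) (λ {z} _ → assign⊆ (suc t) P j (v [ j ]≔ z))) (<⇒≤ low)
  ... | no high = ≤-trans (♯-mono (upTo m) (λ {z} _ → later z)) (assign-codeg t (keep P) j v)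
    where
    later : ∀ z → assign (suc t) P j (v [ j ]≔ z) ≡ true → assign t (keep P) j (v [ j ]≔ z) ≡ true
    later z e with keep P (v [ j ]≔ z)
    ... | true  = e
    ... | false = contradiction (subst (_< d) same (does⇒ (_ <? d) (proj₂ (∧-true {P (v [ j ]≔ z)} e)))) high
      where
      same : codeg P (v [ j ]≔ z) j ≡ codeg P v j
      same = ∑-cong (upTo m) (λ y → cong (ind ∘ P) ([]≔-idempotent v j))

  NoFull : ∀ {s} → Rel s → Set
  NoFull P = ∀ Q → (∀ v → Q v ≡ true → P v ≡ true) → Full m d Q → ∀ v → Q v ≡ true → ⊥

  keep⊆ : ∀ {s} (P : Rel s) v → keep P v ≡ true → P v ≡ true
  keep⊆ P v e = proj₁ (∧-true e)

  -- A round that removes nothing shows the relation to be full, which `NoFull` excludes once it has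
  -- a tuple. So each round removes a tuple, and as many rounds as tuples suffice.
  assign-cover : ∀ {s} t (P : Rel s) → (∀ v → P v ≡ true → v ∈ vecs m s) → NoFull P →
                 ♯ P (vecs m s) ≤ t → ∀ v → P v ≡ true → ∃ λ j → assign t P j v ≡ true
  assign-cover zero P box nf le v Pv = contradiction (≤-trans (♯-positive P (box v Pv) Pv) le) λ ()
  assign-cover {s} (suc t) P box nf le v Pv with keep P v in eq
  ... | false = low (¬∀⟶∃¬ s _ (λ j → d ≤? codeg P v j) λ r → contradiction (trans (sym eq) (kept r)) λ ())
    where
    kept : (∀ j → d ≤ codeg P v j) → keep P v ≡ true
    kept r rewrite Pv = dec-true (rich? P v) r
    low : (∃ λ j → ¬ d ≤ codeg P v j) → ∃ λ j → P v ∧ does (codeg P v j <? d) ≡ true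
    low (j , ≰) rewrite Pv = j , dec-true (codeg P v j <? d) (≰⇒> ≰)
  assign-cover {s} (suc t) P box nf le v Pv | true
    with any? (λ w → (P w Boolₚ.≟ true) ×-dec (keep P w Boolₚ.≟ false)) (vecs m s)
  ... | yes some = let w , w∈ , Pw , ¬kw = find some in
        assign-cover t (keep P) (λ u → box u ∘ keep⊆ P u) (λ Q Q⊆ → nf Q (λ u → keep⊆ P u ∘ Q⊆ u))
          (s≤s⁻¹ (≤-trans (♯-strict (keep⊆ P) w∈ ¬kw Pw) le)) v eq
  ... | no none = ⊥-elim (nf P (λ _ e → e) full v Pv)
    where
    full : Full m d P
    full e Pe with keep P e in eq
    ... | true  = does⇒ (rich? P e) (proj₂ (∧-true {P e} eq))
    ... | false = contradiction (lose (box e Pe) (Pe , eq)) none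

  peel : ∀ {s} → Rel s → Fin s → Rel s
  peel {s} P = assign (♯ P (vecs m s)) P

  peel⊆ : ∀ {s} (P : Rel s) j v → peel P j v ≡ true → P v ≡ true
  peel⊆ {s} P = assign⊆ (♯ P (vecs m s)) P

  peel-insert : ∀ {s} (P : Rel (suc s)) j t → ♯ (λ z → peel P j (insertAt t j z)) (upTo m) ≤ d
  -- The codegree overwrites slot `j`, so 0 can stand there.
  peel-insert {s} P j t = ≤-trans (≤-reflexive (∑-cong (upTo m) λ z → cong (ind ∘ peel P j) (sym (insertAt-update t j 0 z))))
                              (assign-codeg (♯ P (vecs m (suc s))) P j (insertAt t j 0))

  peel-cover : ∀ {s} (P : Rel s) → (∀ v → P v ≡ true → v ∈ vecs m s) → NoFull P →
               ∀ v → P v ≡ true → ∃ λ j → peel P j v ≡ true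
  peel-cover P box nf = assign-cover _ P box nf ≤-refl

  -- Each tuple lies in the part of some slot `j`, and this part has at most `d` tuples on each of
  -- the `m ^ s` lines in direction `j`.
  NoFull⇒sparse : ∀ {s} (P : Rel (suc s)) → (∀ v → P v ≡ true → v ∈ vecs m (suc s)) → NoFull P →
                  ♯ P (vecs m (suc s)) ≤ suc s * (m ^ s * d)
  NoFull⇒sparse {s} P box nf = begin
    ♯ P (vecs m (suc s))
      ≤⟨ ∑-mono (vecs m (suc s)) (λ {v} _ → cover v) ⟩
    ∑ (vecs m (suc s)) (λ v → ∑ (allFin (suc s)) (λ j → ind (peel P j v)))
      ≡⟨ ∑-swap (vecs m (suc s)) (allFin (suc s)) _ ⟩
    ∑ (allFin (suc s)) (λ j → ♯ (peel P j) (vecs m (suc s)))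
      ≤⟨ ∑-mono (allFin (suc s)) (λ {j} _ → slot j) ⟩
    ∑ (allFin (suc s)) (λ j → m ^ s * d)
      ≡⟨ ∑-const (allFin (suc s)) _ ⟩
    length (allFin (suc s)) * (m ^ s * d)
      ≡⟨ cong (_* (m ^ s * d)) (length-tabulate (λ (i : Fin (suc s)) → i)) ⟩
    suc s * (m ^ s * d) ∎
    where
    open ≤-Reasoning
    cover : ∀ v → ind (P v) ≤ ∑ (allFin (suc s)) (λ j → ind (peel P j v))
    cover v with P v in eq
    ... | false = z≤n
    ... | true  = let j , e = peel-cover P box nf v eq in ♯-positive (λ j → peel P j v) (∈-allFin j) e
    slot : ∀ j → ♯ (peel P j) (vecs m (suc s)) ≤ m ^ s * d
    slot j = begin
      ♯ (peel P j) (vecs m (suc s))                                             ≡⟨ ∑-insertAt m s j _ ⟩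
      ∑ (vecs m s) (λ t → ♯ (λ z → peel P j (insertAt t j z)) (upTo m))         ≤⟨ ∑-mono (vecs m s) (λ {t} _ → peel-insert P j t) ⟩
      ∑ (vecs m s) (λ _ → d)                                                    ≡⟨ ∑-const (vecs m s) d ⟩
      length (vecs m s) * d                                                     ≡⟨ cong (_* d) (length-vecs m s) ⟩
      m ^ s * d                                                                 ∎

-- Projections to intervals and their code

++-split : (xs xs′ : List A) {ys ys′ : List A} → length xs ≡ length xs′ → xs ++ ys ≡ xs′ ++ ys′ → xs ≡ xs′ × ys ≡ ys′
++-split []       []         l e = refl , e
++-split (x ∷ xs) (x′ ∷ xs′) l e =
  let e₁ , e₂ = ∷-injective e ; a , b = ++-split xs xs′ (suc-injective l) e₂ in cong₂ _∷_ e₁ a , b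

concatMap-split : {f g : A → List B} → (∀ x → length (f x) ≡ length (g x)) → ∀ xs {ys ys′} →
                  concatMap f xs ++ ys ≡ concatMap g xs ++ ys′ → (∀ {x} → x ∈ xs → f x ≡ g x) × ys ≡ ys′
concatMap-split len [] e = (λ ()) , e
concatMap-split {f = f} {g} len (x ∷ xs) {ys} {ys′} e =
  let a , b = ++-split (f x) (g x) (len x) (trans (sym (++-assoc (f x) _ ys)) (trans e (++-assoc (g x) _ ys′)))
      c , d = concatMap-split len xs b
  in (λ { (here refl) → a ; (there x∈) → c x∈ }) , d

map-≡⁻ : {f g : A → B} (xs : List A) → map f xs ≡ map g xs → ∀ {x} → x ∈ xs → f x ≡ g x
map-≡⁻ (y ∷ xs) e (here refl) = proj₁ (∷-injective e)
map-≡⁻ (y ∷ xs) e (there x∈)  = map-≡⁻ xs (proj₂ (∷-injective e)) x∈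

select-cong : {p q : A → Bool} (xs : List A) → (∀ {x} → x ∈ xs → p x ≡ q x) → select p xs ≡ select q xs
select-cong [] h = refl
select-cong {p = p} {q} (x ∷ xs) h with p x | q x | h (here refl)
... | true  | _ | refl = cong (x ∷_) (select-cong xs (h ∘ there))
... | false | _ | refl = select-cong xs (h ∘ there)

length-concatMap : (f : A → List B) (xs : List A) → length (concatMap f xs) ≡ ∑ xs (length ∘ f)
length-concatMap f []       = refl
length-concatMap f (x ∷ xs) = trans (length-++ (f x)) (cong (length (f x) +_) (length-concatMap f xs))

refine : ∀ {s} → ℕ → Vec ℕ s → Vec ℕ s → Vec ℕ s
refine q = zipWith (λ x y → x * q + y)

refine-bound : ∀ {s N q} {u w : Vec ℕ s} → VAll (_< N) u → VAll (_< q) w → VAll (_< N * q) (refine q u w)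
refine-bound [] [] = []
refine-bound {N = N} {q} (x< ∷ us) (y< ∷ ws) =
  ≤-trans (+-monoʳ-< _ y<) (≤-trans (≤-reflexive (+-comm _ q)) (*-monoˡ-≤ q x<)) ∷ refine-bound us ws

refine-refine : ∀ {s} b q (u w c : Vec ℕ s) → refine b (refine q u w) c ≡ refine (b * q) u (refine b w c)
refine-refine b q [] [] [] = refl
refine-refine b q (x ∷ u) (y ∷ w) (z ∷ c) = cong₂ _∷_ (eq x y z b q) (refine-refine b q u w c)
  where
  eq : ∀ x y z b q → (x * q + y) * b + z ≡ x * (b * q) + (y * b + z)
  eq = solve-∀

divide : ∀ {s} b .{{_ : NonZero b}} (v : Vec ℕ s) → refine b (Vec.map (_/ b) v) (Vec.map (_% b) v) ≡ v
divide b []      = refl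
divide b (x ∷ v) = cong₂ _∷_ (trans (+-comm _ (x % b)) (sym (m≡m%n+[m/n]*n x b))) (divide b v)

quot-bound : ∀ {s N} b .{{_ : NonZero b}} {v : Vec ℕ s} → VAll (_< N * b) v → VAll (_< N) (Vec.map (_/ b) v)
quot-bound b [] = []
quot-bound b (x< ∷ a) = m<n*o⇒m/o<n x< ∷ quot-bound b a

rem-bound : ∀ {s} b .{{_ : NonZero b}} (v : Vec ℕ s) → VAll (_< b) (Vec.map (_% b) v)
rem-bound b []      = []
rem-bound b (x ∷ v) = m%n<n x b ∷ rem-bound b v

module Project (b : ℕ) .{{_ : NonZero b}} where

  up : ∀ {s} → Rel s → Rel s
  up {s} P u = does (any? (λ c → P (refine b u c) Boolₚ.≟ true) (vecs b s))

  up⁻ : ∀ {s} (P : Rel s) u → up P u ≡ true → ∃ λ c → c ∈ vecs b s × P (refine b u c) ≡ true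
  up⁻ {s} P u e = find (does⇒ (any? (λ c → P (refine b u c) Boolₚ.≟ true) (vecs b s)) e)

  up⁺ : ∀ {s} (P : Rel s) u {c} → c ∈ vecs b s → P (refine b u c) ≡ true → up P u ≡ true
  up⁺ {s} P u c∈ e = dec-true (any? (λ c → P (refine b u c) Boolₚ.≟ true) (vecs b s)) (lose c∈ e)

  ups : ∀ {s} → ℕ → Rel s → Rel s
  ups zero    P = P
  ups (suc i) P = ups i (up P)

  ups⁻ : ∀ {s} i (P : Rel s) u → ups i P u ≡ true → ∃ λ w → VAll (_< b ^ i) w × P (refine (b ^ i) u w) ≡ true
  ups⁻ zero P u e = replicate _ 0 , zeros _ , trans (cong P (id-refine u)) e
    where
    zeros : ∀ s → VAll (_< 1) (replicate s 0)
    zeros zero    = []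
    zeros (suc s) = s≤s z≤n ∷ zeros s
    id-refine : ∀ {s} (u : Vec ℕ s) → refine 1 u (replicate s 0) ≡ u
    id-refine []      = refl
    id-refine (x ∷ u) = cong₂ _∷_ (trans (+-identityʳ _) (*-identityʳ x)) (id-refine u)
  ups⁻ (suc i) P u e =
    let w , w< , e₁ = ups⁻ i (up P) u e
        c , c∈ , e₂ = up⁻ P (refine (b ^ i) u w) e₁
    in refine b w c ,
       subst (λ h → VAll (_< h) (refine b w c)) (*-comm (b ^ i) b) (refine-bound w< (∈-vecs⁻ c∈)) ,
       trans (cong P (sym (refine-refine b (b ^ i) u w c))) e₂

  -- Only cells below occupied coarse tuples are recorded. The decoder knows these cells from the
  -- coarser levels and knows all others to be empty.
  bits : ∀ {s} → ℕ → Rel s → List Bool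
  bits {s} L P = concatMap (λ u → map (λ c → P (refine b u c)) (vecs b s)) (select (up P) (vecs (b ^ L) s))

  code : ∀ {s} → ℕ → Rel s → List Bool
  code {s} zero P = [ P (replicate s 0) ]
  code (suc L) P = code L (up P) ++ bits L P

  _≈[_]_ : ∀ {s} → Rel s → ℕ → Rel s → Set
  P ≈[ N ] P′ = ∀ v → VAll (_< N) v → P v ≡ P′ v

  -- The tails are arbitrary because the length of a code varies with the relation, so one has to
  -- find where the coarse part ends. When the coarse projections agree, the lists of occupied cells
  -- coincide, the fine parts have equal length, and they can be split off.
  code-prefix : ∀ {s} L (P P′ : Rel s) {x x′} → code L P ++ x ≡ code L P′ ++ x′ → P ≈[ b ^ L ] P′ × x ≡ x′
  code-prefix zero P P′ e = let a , c = ∷-injective e in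
    (λ v v< → subst (λ h → P h ≡ P′ h) (zero-vec v v<) a) , c
    where
    zero-vec : ∀ {s} (v : Vec ℕ s) → VAll (_< 1) v → replicate s 0 ≡ v
    zero-vec [] [] = refl
    zero-vec (zero ∷ v) (_ ∷ a) = cong (0 ∷_) (zero-vec v a)
    zero-vec (suc _ ∷ v) (s≤s () ∷ a)
  code-prefix {s} (suc L) P P′ {x} {x′} e =
    let eqU , e₁ = code-prefix L (up P) (up P′) (trans (sym (++-assoc (code L (up P)) _ x)) (trans e (++-assoc (code L (up P′)) _ x′)))
        sel = select-cong {p = up P} {up P′} (vecs (b ^ L) s) (λ {u} u∈ → eqU u (∈-vecs⁻ u∈))
        eqB , e₂ = concatMap-split (λ u → trans (length-map _ (vecs b s)) (sym (length-map _ (vecs b s)))) (select (up P) (vecs (b ^ L) s))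
                     (trans e₁ (cong (λ h → concatMap (λ u → map (λ c → P′ (refine b u c)) (vecs b s)) h ++ x′) (sym sel)))
        eqP : ∀ u → VAll (_< b ^ L) u → ∀ c → VAll (_< b) c → P (refine b u c) ≡ P′ (refine b u c)
        -- A tuple in either relation makes its cell occupied in both, and there the recorded bits
        -- agree.
        eqP u u< c c< = bool-ext
          (λ Pc → trans (sym (map-≡⁻ (vecs b s) (eqB (∈-select⁺ (up P) (∈-vecs⁺ u<) (up⁺ P u (∈-vecs⁺ c<) Pc))) (∈-vecs⁺ c<))) Pc)
          (λ Pc → trans (map-≡⁻ (vecs b s) (eqB (∈-select⁺ (up P) (∈-vecs⁺ u<) (trans (eqU u u<) (up⁺ P′ u (∈-vecs⁺ c<) Pc)))) (∈-vecs⁺ c<)) Pc)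
    in (λ v v< → subst (λ h → P h ≡ P′ h) (divide b v)
         (eqP (Vec.map (_/ b) v) (quot-bound b (subst (λ h → VAll (_< h) v) (*-comm b (b ^ L)) v<)) (Vec.map (_% b) v) (rem-bound b v))) , e₂

  length-bits : ∀ {s} L (P : Rel s) → length (bits L P) ≡ b ^ s * ♯ (up P) (vecs (b ^ L) s)
  length-bits {s} L P = begin
    length (bits L P)                                  ≡⟨ length-concatMap _ sel ⟩
    ∑ sel (λ u → length (map (λ c → P (refine b u c)) (vecs b s)))
      ≡⟨ ∑-cong sel (λ u → trans (length-map _ (vecs b s)) (length-vecs b s)) ⟩
    ∑ sel (λ _ → b ^ s)                                ≡⟨ ∑-const sel (b ^ s) ⟩
    length sel * b ^ s                                 ≡⟨ cong (_* b ^ s) (length-select (up P) (vecs (b ^ L) s)) ⟩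
    ♯ (up P) (vecs (b ^ L) s) * b ^ s                  ≡⟨ *-comm _ (b ^ s) ⟩
    b ^ s * ♯ (up P) (vecs (b ^ L) s)                  ∎
    where
    open ≡-Reasoning
    sel = select (up P) (vecs (b ^ L) s)

  LevelBound : ∀ {s} → ℕ → Rel s → ℕ → Set
  LevelBound {s} L P M = ∀ i → i ≤ L → 2 ^ i * ♯ (ups i P) (vecs (b ^ (L ∸ i)) s) ≤ M

  -- The i-th level contributes at most M / 2ⁱ, and the geometric series is summed from the top.
  code-length′ : ∀ {s} L (P : Rel s) M t → (∀ i → i ≤ L → 2 ^ (t + i) * ♯ (ups i P) (vecs (b ^ (L ∸ i)) s) ≤ M) →
                 ∃ λ l → length (code L P) ≡ suc l × 2 ^ t * l ≤ b ^ s * M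
  code-length′ zero P M t h = 0 , refl , ≤-trans (≤-reflexive (*-zeroʳ (2 ^ t))) z≤n
  code-length′ {s} (suc L) P M t h =
    let l , e , le = code-length′ L (up P) M (suc t)
          (λ i i≤ → subst (λ h → 2 ^ h * ♯ (ups i (up P)) (vecs (b ^ (L ∸ i)) s) ≤ M) (+-suc t i) (h (suc i) (s≤s i≤)))
        a = ♯ (up P) (vecs (b ^ L) s)
        h₁ : 2 ^ suc t * a ≤ M
        h₁ = subst (λ h → 2 ^ h * a ≤ M) (+-comm t 1) (h 1 (s≤s z≤n))
    in l + b ^ s * a ,
       trans (length-++ (code L (up P))) (cong₂ _+_ e (length-bits L P)) ,
       *-cancelˡ-≤ 2 (begin
         2 * (2 ^ t * (l + b ^ s * a))              ≡⟨ eq (2 ^ t) l (b ^ s) a ⟩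
         2 ^ suc t * l + b ^ s * (2 ^ suc t * a)    ≤⟨ +-mono-≤ le (*-monoʳ-≤ (b ^ s) h₁) ⟩
         b ^ s * M + b ^ s * M                      ≡⟨ cong (b ^ s * M +_) (sym (+-identityʳ _)) ⟩
         2 * (b ^ s * M)                            ∎)
    where
    open ≤-Reasoning
    eq : ∀ T l B a → 2 * (T * (l + B * a)) ≡ (2 * T) * l + B * ((2 * T) * a)
    eq = solve-∀

  code-length : ∀ {s} L (P : Rel s) M → LevelBound L P M → length (code L P) ≤ suc (b ^ s * M)
  code-length L P M h = let l , e , le = code-length′ L P M 0 h in
    ≤-trans (≤-reflexive e) (s≤s (≤-trans (≤-reflexive (sym (+-identityʳ l))) le))

-- Rainbow systems in boxes of intervals

^-distribʳ : ∀ m n s → (m * n) ^ s ≡ m ^ s * n ^ s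
^-distribʳ m n zero    = refl
^-distribʳ m n (suc s) = trans (cong (m * n *_) (^-distribʳ m n s)) ([m*n]*[o*p]≡[m*o]*[n*p] m n (m ^ s) (n ^ s))

digit-< : ∀ {q x y a b} → x < y → a < q → x * q + a < y * q + b
digit-< {q} {x} x<y a< = ≤-trans (+-monoʳ-< (x * q) a<)
  (≤-trans (≤-reflexive (+-comm (x * q) q)) (≤-trans (*-monoˡ-≤ q x<y) (m≤m+n _ _)))

digit-injective : ∀ {q x y a b} → a < q → b < q → x * q + a ≡ y * q + b → x ≡ y
digit-injective {q} {x} {y} {a} {b} a< b< e with <-cmp x y
... | tri≈ _ x≡y _ = x≡y
... | tri< x<y _ _ = contradiction e (<⇒≢ (digit-< x<y a<))
... | tri> _ _ y<x = contradiction (sym e) (<⇒≢ (digit-< y<x b<))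

Unique-map⁻ : {f : A → B} {xs : List A} → Unique (map f xs) → ∀ {x y} → x ∈ xs → y ∈ xs → f x ≡ f y → x ≡ y
Unique-map⁻ (a ∷ u) (here refl) (here refl) e = refl
Unique-map⁻ {f = f} (a ∷ u) (here refl) (there y∈) e = contradiction e (All.lookup a (∈-map⁺ f y∈))
Unique-map⁻ {f = f} (a ∷ u) (there x∈) (here refl) e = contradiction (sym e) (All.lookup a (∈-map⁺ f x∈))
Unique-map⁻ (a ∷ u) (there x∈) (there y∈) e = Unique-map⁻ u x∈ y∈ e

map-select-Unique : (f : A → B) (p : A → Bool) {xs : List A} → Unique (map f xs) → Unique (map f (select p xs))
map-select-Unique f p {[]} _ = []
map-select-Unique f p {x ∷ xs} (a ∷ u) with p x
... | false = map-select-Unique f p u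
... | true  = All.tabulate (λ y∈ e → let z , z∈ , e′ = ∈-map⁻ f y∈ in
                All.lookup a (∈-map⁺ f (proj₁ (∈-select⁻ p xs z∈))) (trans e e′))
              ∷ map-select-Unique f p u

module Rainbow (b : ℕ) .{{_ : NonZero b}} {s : ℕ} where
  open Project b

  record RainbowIn (A : Rel (suc s)) (i : ℕ) (t : Vec ℕ s) : Set where
    field
      G         : Rel s
      colour    : Vec ℕ s → ℕ
      inBox     : ∀ {w} → G w ≡ true → VAll (_< b ^ i) w
      member    : ∀ {w} → G w ≡ true → A (colour w ∷ refine (b ^ i) t w) ≡ true
      injective : ∀ {w w′} → G w ≡ true → G w′ ≡ true → colour w ≡ colour w′ → w ≡ w′
  open RainbowIn public

  module _ (A : Rel (suc s)) (L d : ℕ)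
           (codeg : ∀ t → ♯ (λ z → A (z ∷ t)) (upTo (b ^ L)) ≤ d) where

    module Reps (i : ℕ) (i≤L : i ≤ L) (t : Vec ℕ s) where
      q = b ^ i
      N = b ^ (L ∸ i)

      N*q : N * q ≡ b ^ L
      N*q = trans (sym (^-distribˡ-+-* b (L ∸ i) i)) (cong (b ^_) (m∸n+n≡m i≤L))

      Rep : Set
      Rep = ℕ × Vec ℕ s

      record Good (Zs : List ℕ) (p : Rep) : Set where
        constructor good
        field
          {group digit} : ℕ
          group∈  : group ∈ Zs
          digit<  : digit < q
          colour≡ : proj₁ p ≡ group * q + digit
          box     : VAll (_< q) (proj₂ p)
          inA     : A (proj₁ p ∷ refine q t (proj₂ p)) ≡ true
      open Good

      weaken : ∀ {Zs Z p} → Good Zs p → Good (Z ∷ Zs) p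
      weaken (good a b c d e) = good (there a) b c d e

      -- One witness is taken for each occupied colour interval; colours from different intervals
      -- differ, which makes the chosen system rainbow.
      reps : ∀ Zs → Unique Zs → (∀ {Z} → Z ∈ Zs → ups i A (Z ∷ t) ≡ true) →
             ∃ λ ps → length ps ≡ length Zs × All (Good Zs) ps × Unique (map proj₁ ps)
      reps [] _ _ = [] , refl , [] , []
      reps (Z ∷ Zs) (Z≢ ∷ u) h with ups⁻ i A (Z ∷ t) (h (here refl)) | reps Zs u (h ∘ there)
      ... | z ∷ w , z< ∷ w< , Aw | ps , len , gs , ups =
        (Z * q + z , w) ∷ ps , cong suc len ,
        good (here refl) z< refl w< Aw ∷ All.map weaken gs ,
        All.tabulate (λ y∈ e → let p , p∈ , e′ = ∈-map⁻ proj₁ y∈ ; g = All.lookup gs p∈ in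
          All.lookup Z≢ (group∈ g) (digit-injective z< (digit< g) (trans e (trans e′ (colour≡ g))))) ∷ ups

      Zs : List ℕ
      Zs = select (λ Z → ups i A (Z ∷ t)) (upTo N)

      chosen = reps Zs (select-Unique _ (Uniqueₚ.upTo⁺ N)) (λ Z∈ → proj₂ (∈-select⁻ _ (upTo N) Z∈))
      ps = proj₁ chosen
      ps-good : All (Good Zs) ps
      ps-good = proj₁ (proj₂ (proj₂ chosen))
      ps-unique : Unique (map proj₁ ps)
      ps-unique = proj₂ (proj₂ (proj₂ chosen))

      _≟ᵥ_ : (v w : Vec ℕ s) → Dec (v ≡ w)
      _≟ᵥ_ = ≡-dec _≟_

      search : ∀ w → Dec (Any (λ p → proj₂ p ≡ w) ps)
      search w = any? (λ p → proj₂ p ≟ᵥ w) ps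

      pickColour : ∀ {w} → Dec (Any (λ p → proj₂ p ≡ w) ps) → ℕ
      pickColour (yes a) = proj₁ (proj₁ (find a))
      -- A dummy: `RainbowIn` constrains `colour` only where `G` holds.
      pickColour (no _)  = 0

      found : ∀ {w} (d : Dec (Any (λ p → proj₂ p ≡ w) ps)) → does d ≡ true → ∃ λ p → p ∈ ps × proj₂ p ≡ w × pickColour d ≡ proj₁ p
      found (yes a) _ = let p , p∈ , e = find a in p , p∈ , e , refl

      rainbow : RainbowIn A i t
      rainbow .G w = does (search w)
      rainbow .colour w = pickColour (search w)
      rainbow .inBox {w} e with p , p∈ , refl , c≡ ← found (search w) e = box (All.lookup ps-good p∈)
      rainbow .member {w} e = let p , p∈ , e₁ , c≡ = found (search w) e in
        subst₂ (λ c w → A (c ∷ refine q t w) ≡ true) (sym c≡) e₁ (inA (All.lookup ps-good p∈))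
      rainbow .injective {w} {w′} e e′ c≡ =
        let p , p∈ , e₁ , e₂ = found (search w) e
            p′ , p′∈ , e₁′ , e₂′ = found (search w′) e′
        in trans (sym e₁) (trans (cong proj₂ (Unique-map⁻ ps-unique p∈ p′∈ (trans (sym e₂) (trans c≡ e₂′)))) e₁′)

      at : Vec ℕ s → Rep → Bool
      at w p = does (proj₂ p ≟ᵥ w)

      -- Witnesses with the same tuple `w` have distinct colours, and all these colours extend one
      -- tuple in `A`, so the codegree bound applies.
      fibre : ∀ w → ♯ (at w) ps ≤ d * ind (rainbow .G w)
      fibre w with does (search w) in eq
      ... | true = ≤-trans (≤-reflexive (trans (sym (length-select (at w) ps)) (sym (length-map proj₁ (select (at w) ps)))))
                    (≤-trans (Unique-⊆-length (map-select-Unique proj₁ (at w) ps-unique) into)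
                      (≤-trans (≤-reflexive (length-select _ (upTo (b ^ L)))) (≤-trans (codeg (refine q t w)) (≤-reflexive (sym (*-identityʳ d))))))
        where
        into : ∀ {c} → c ∈ map proj₁ (select (at w) ps) → c ∈ select (λ z → A (z ∷ refine q t w)) (upTo (b ^ L))
        into c∈ with p , p∈ , refl ← ∈-map⁻ proj₁ c∈
                with p∈ps , e ← ∈-select⁻ (at w) ps p∈
                with g ← All.lookup ps-good p∈ps
                with refl ← does⇒ (proj₂ p ≟ᵥ w) e =
          ∈-select⁺ _ (∈-upTo⁺ (subst₂ _<_ (sym (colour≡ g)) N*q
            (≤-trans (+-monoʳ-< (group g * q) (digit< g)) (≤-trans (≤-reflexive (+-comm (group g * q) q))
              (*-monoˡ-≤ q (∈-upTo⁻ (proj₁ (∈-select⁻ _ (upTo N) (group∈ g))))))))) (inA g)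
      ... | false = ≤-trans (none ps (λ {p} p∈ e → contradiction (trans (sym eq) (dec-true (search w) (lose p∈ (does⇒ (proj₂ p ≟ᵥ w) e)))) λ ())) z≤n
        where
        none : ∀ xs → (∀ {p} → p ∈ xs → ¬ at w p ≡ true) → ♯ (at w) xs ≤ 0
        none xs h = ≤-trans (∑-mono xs {g = λ _ → 0} (λ {p} p∈ → ind-false (h p∈))) (≤-reflexive (trans (∑-const xs 0) (*-zeroʳ (length xs))))
          where
          ind-false : ∀ {a} → ¬ a ≡ true → ind a ≤ 0
          ind-false {false} _ = z≤n
          ind-false {true}  n = ⊥-elim (n refl)

      groups-bound : ♯ (λ Z → ups i A (Z ∷ t)) (upTo N) ≤ d * ♯ (rainbow .G) (vecs q s)
      groups-bound = begin
        ♯ (λ Z → ups i A (Z ∷ t)) (upTo N)                 ≡⟨ sym (length-select _ (upTo N)) ⟩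
        length Zs                                          ≡⟨ sym (proj₁ (proj₂ chosen)) ⟩
        length ps                                          ≡⟨ length≡∑ ps ⟩
        ∑ ps (λ _ → 1)                                     ≤⟨ ∑-mono ps (λ {p} p∈ → ♯-positive (λ w → at w p) (∈-vecs⁺ (box (All.lookup ps-good p∈))) (dec-true (proj₂ p ≟ᵥ proj₂ p) refl)) ⟩
        ∑ ps (λ p → ∑ (vecs q s) (λ w → ind (at w p)))     ≡⟨ ∑-swap ps (vecs q s) _ ⟩
        ∑ (vecs q s) (λ w → ♯ (at w) ps)                   ≤⟨ ∑-mono (vecs q s) (λ {w} _ → fibre w) ⟩
        ∑ (vecs q s) (λ w → d * ind (rainbow .G w))        ≡⟨ ∑-*ˡ d (vecs q s) _ ⟨
        d * ♯ (rainbow .G) (vecs q s)                      ∎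
        where open ≤-Reasoning

    -- There are `(b ^ (L ∸ i)) ^ s` boxes. In each of them the occupied colour intervals are at
    -- most `d` times as many as the tuples of a rainbow system, and the powers of both scales
    -- multiply to `(b ^ L) ^ s`.
    rainbow⇒LevelBound : ∀ K → (∀ i t (R : RainbowIn A i t) → 2 ^ i * ♯ (R .G) (vecs (b ^ i) s) ≤ K * (b ^ i) ^ s) →
                         LevelBound L A (d * K * (b ^ L) ^ s)
    rainbow⇒LevelBound K h i i≤L = begin
      2 ^ i * ♯ (ups i A) (vecs N′ (suc s))
        ≡⟨ cong (2 ^ i *_) (∑-vecs-suc N′ s _) ⟩
      2 ^ i * ∑ (vecs N′ s) (λ t → ♯ (λ Z → ups i A (Z ∷ t)) (upTo N′))
        ≡⟨ ∑-*ˡ (2 ^ i) (vecs N′ s) _ ⟩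
      ∑ (vecs N′ s) (λ t → 2 ^ i * ♯ (λ Z → ups i A (Z ∷ t)) (upTo N′))
        ≤⟨ ∑-mono (vecs N′ s) (λ {t} _ → perGroup t) ⟩
      ∑ (vecs N′ s) (λ t → d * (K * q′ ^ s))
        ≡⟨ ∑-const (vecs N′ s) _ ⟩
      length (vecs N′ s) * (d * (K * q′ ^ s))
        ≡⟨ cong (_* (d * (K * q′ ^ s))) (length-vecs N′ s) ⟩
      N′ ^ s * (d * (K * q′ ^ s))
        ≡⟨ eq (N′ ^ s) d K (q′ ^ s) ⟩
      d * K * (N′ ^ s * q′ ^ s)
        ≡⟨ cong (d * K *_) (sym (^-distribʳ N′ q′ s)) ⟩
      d * K * (N′ * q′) ^ s
        ≡⟨ cong (λ h → d * K * h ^ s) (Reps.N*q i i≤L (Vec.replicate s 0)) ⟩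
      d * K * (b ^ L) ^ s ∎
      where
      open ≤-Reasoning
      N′ = b ^ (L ∸ i)
      q′ = b ^ i
      eq : ∀ n d k q → n * (d * (k * q)) ≡ d * k * (n * q)
      eq = solve-∀
      eq′ : ∀ a d g → a * (d * g) ≡ d * (a * g)
      eq′ = solve-∀
      perGroup : ∀ t → 2 ^ i * ♯ (λ Z → ups i A (Z ∷ t)) (upTo N′) ≤ d * (K * q′ ^ s)
      perGroup t = begin
        2 ^ i * ♯ (λ Z → ups i A (Z ∷ t)) (upTo N′)       ≤⟨ *-monoʳ-≤ (2 ^ i) (Reps.groups-bound i i≤L t) ⟩
        2 ^ i * (d * ♯ (Reps.rainbow i i≤L t .G) (vecs q′ s))   ≡⟨ eq′ (2 ^ i) d _ ⟩
        d * (2 ^ i * ♯ (Reps.rainbow i i≤L t .G) (vecs q′ s))   ≤⟨ *-monoʳ-≤ d (h i t (Reps.rainbow i i≤L t)) ⟩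
        d * (K * q′ ^ s)                                   ∎

-- Encodings

record Enc (X : Set) (T : X → X → Set) (M : ℕ) : Set where
  constructor enc
  field
    encode : X → Vec Bool M
    sound  : ∀ a b → encode a ≡ encode b → T a b
open Enc public

Enc-map : (∀ a b → T a b → T′ a b) → Enc X T M → Enc X T′ M
Enc-map h (enc f s) = enc f (λ a b e → h a b (s a b e))

Enc-× : Enc X T M → Enc X T′ M′ → Enc X (λ a b → T a b × T′ a b) (M + M′)
Enc-× (enc f s) (enc g t) = enc (λ x → f x Vec.++ g x) λ a b e →
  let e₁ , e₂ = Vec-++-injective (f a) (f b) e in s a b e₁ , t a b e₂

Enc-≤ : M ≤ M′ → Enc X T M → Enc X T M′
Enc-≤ {M} {M′} {X} {T} M≤ E = subst (Enc X T) (m+[n∸m]≡n M≤)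
  (Enc-map (λ _ _ → proj₁) (Enc-× {T′ = λ _ _ → ⊤} E (enc (λ _ → replicate (M′ ∸ M) false) λ _ _ _ → tt)))

-- Each bit is preceded by the flag `true`, and padding begins with `false`, so the length of the
-- list can be read off. This costs the factor 2 in the sizes below.
pad : (M : ℕ) → List Bool → Vec Bool (M * 2)
pad zero    _        = []
pad (suc M) []       = false ∷ false ∷ pad M []
pad (suc M) (x ∷ xs) = true ∷ x ∷ pad M xs

pad-injective : ∀ M {xs ys} → length xs ≤ M → length ys ≤ M → pad M xs ≡ pad M ys → xs ≡ ys
pad-injective zero    {[]}     {[]}     _ _ _ = refl
pad-injective (suc M) {[]}     {[]}     _ _ _ = refl
pad-injective (suc M) {[]}     {y ∷ ys} _ _ ()
pad-injective (suc M) {x ∷ xs} {[]}     _ _ ()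
pad-injective (suc M) {x ∷ xs} {y ∷ ys} (s≤s l) (s≤s l′) e =
  let _ , e₁ = Vec-∷-injective e ; e₂ , e₃ = Vec-∷-injective e₁
  in cong₂ _∷_ e₂ (pad-injective M l l′ e₃)

Enc-list : (f : X → List Bool) → (∀ x → length (f x) ≤ M) → (∀ a b → f a ≡ f b → T a b) → Enc X T (M * 2)
Enc-list {M = M} f len s = enc (pad M ∘ f) λ a b e → s a b (pad-injective M (len a) (len b) e)

Enc-∀ : ∀ c {T : Fin c → X → X → Set} → (∀ j → Enc X (T j) M) → Enc X (λ a b → ∀ j → T j a b) (c * M)
Enc-∀ zero    E = enc (λ _ → []) λ _ _ _ ()
Enc-∀ (suc c) E = Enc-map (λ { _ _ (p , q) zero → p ; _ _ (p , q) (suc j) → q j })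
                          (Enc-× (E zero) (Enc-∀ c (E ∘ suc)))

Agree : ∀ {s} → ℕ → Rel s → Rel s → Set
Agree N P P′ = ∀ v → VAll (_< N) v → P v ≡ P′ v

Enc-relation : ∀ {s} N (P : X → Rel s) → Enc X (λ a b → Agree N (P a) (P b)) (N ^ s * 2)
Enc-relation {s = s} N P = Enc-list (λ x → map (P x) (vecs N s))
  (λ x → ≤-reflexive (trans (length-map (P x) (vecs N s)) (length-vecs N s)))
  λ a b e v v< → map-≡⁻ (vecs N s) e (∈-vecs⁺ v<)

bit : Bool → Fin 2
bit false = zero
bit true  = suc zero

bit-injective : ∀ {a b} → bit a ≡ bit b → a ≡ b
bit-injective {false} {false} _ = refl
bit-injective {true}  {true}  _ = refl

number : ∀ M → Vec Bool M → Fin (2 ^ M)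
number zero    []      = zero
number (suc M) (x ∷ v) = combine (bit x) (number M v)

number-injective : ∀ M v w → number M v ≡ number M w → v ≡ w
number-injective zero    []      []      _ = refl
number-injective (suc M) (x ∷ v) (y ∷ w) e =
  let e₁ , e₂ = combine-injective (bit x) (number M v) (bit y) (number M w) e
  in cong₂ _∷_ (bit-injective e₁) (number-injective M v w e₂)

Enc⇒CardAtMost : ∀ {r n k M} → Enc (Forb r n k) (λ a b → SameEdges (proj₁ a) (proj₁ b)) M → CardAtMost r n k (2 ^ M)
Enc⇒CardAtMost {M = M} (enc f s) = (number M ∘ f) , λ a b e → s a b (number-injective M (f a) (f b) e)

-- Hypergraphs as relations on tuples

elements : ∀ {n} → Subset n → List ℕ
elements []            = []
elements (inside  ∷ S) = 0 ∷ map suc (elements S)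
elements (outside ∷ S) = map suc (elements S)

length-elements : ∀ {n} (S : Subset n) → length (elements S) ≡ ∣ S ∣
length-elements []            = refl
length-elements (inside  ∷ S) = cong suc (trans (length-map suc (elements S)) (length-elements S))
length-elements (outside ∷ S) = trans (length-map suc (elements S)) (length-elements S)

elements-Unique : ∀ {n} (S : Subset n) → Unique (elements S)
elements-Unique []            = []
elements-Unique (inside  ∷ S) = All.tabulate (λ y∈ e → case∈ (∈-map⁻ suc y∈) e) ∷ Uniqueₚ.map⁺ suc-injective (elements-Unique S)
  where
  case∈ : ∀ {y xs} → (∃ λ x → x ∈ xs × y ≡ suc x) → 0 ≢ y
  case∈ (_ , _ , refl) ()
elements-Unique (outside ∷ S) = Uniqueₚ.map⁺ suc-injective (elements-Unique S)

elements-< : ∀ {n} (S : Subset n) → All (_< n) (elements S)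
elements-< []            = []
elements-< (inside  ∷ S) = s≤s z≤n ∷ Allₚ.map⁺ (All.map s≤s (elements-< S))
elements-< (outside ∷ S) = Allₚ.map⁺ (All.map s≤s (elements-< S))

∈-elements⁺ : ∀ {n} (S : Subset n) i → i ∈ₛ S → toℕ i ∈ elements S
∈-elements⁺ (inside  ∷ S) zero    Vec.here       = here refl
∈-elements⁺ (inside  ∷ S) (suc i) (Vec.there i∈) = there (∈-map⁺ suc (∈-elements⁺ S i i∈))
∈-elements⁺ (outside ∷ S) (suc i) (Vec.there i∈) = ∈-map⁺ suc (∈-elements⁺ S i i∈)

∈-elements⁻ : ∀ {n} (S : Subset n) i → toℕ i ∈ elements S → i ∈ₛ S
∈-elements⁻ (inside  ∷ S) zero    _ = Vec.here
∈-elements⁻ (inside  ∷ S) (suc i) (there i∈) with _ , j∈ , refl ← ∈-map⁻ suc i∈ = Vec.there (∈-elements⁻ S i j∈)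
∈-elements⁻ (outside ∷ S) zero    i∈ with () ← proj₂ (proj₂ (∈-map⁻ suc i∈))
∈-elements⁻ (outside ∷ S) (suc i) i∈ with _ , j∈ , refl ← ∈-map⁻ suc i∈ = Vec.there (∈-elements⁻ S i j∈)

toSet-elements : ∀ {n} (S : Subset n) → toSet n (elements S) ≡ S
toSet-elements S = trans (tabulate-cong λ i → bool-ext
    (λ e → []=⇒lookup (∈-elements⁻ S i (does⇒ (toℕ i ∈? elements S) e)))
    (λ e → dec-true (toℕ i ∈? elements S) (∈-elements⁺ S i (lookup⇒[]= i S e))))
  (tabulate∘lookup S)

module _ {r n : ℕ} (H : RGraph r n) where

  edges : Rel r
  edges v = does (isEdge? H (toList v))

  edges⁻ : ∀ v → edges v ≡ true → IsEdge H (toList v)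
  edges⁻ v = does⇒ (isEdge? H (toList v))

  edges⁺ : ∀ v → IsEdge H (toList v) → edges v ≡ true
  edges⁺ v = dec-true (isEdge? H (toList v))

toList-All⁻ : ∀ {s} {P : ℕ → Set} (v : Vec ℕ s) → All P (toList v) → VAll P v
toList-All⁻ []      []       = []
toList-All⁻ (x ∷ v) (p ∷ ps) = p ∷ toList-All⁻ v ps

edges-bounded : ∀ {r n} (H : RGraph r n) v → edges H v ≡ true → VAll (_< n) v
edges-bounded H v e = toList-All⁻ v (inRange (edges⁻ H v e))

-- A set is tested through one of its orderings, the increasing one, which has length `r` by
-- uniformity.
Agree⇒SameEdges : ∀ {r n} (H H′ : RGraph r n) → Agree n (edges H) (edges H′) → SameEdges H H′
Agree⇒SameEdges {r} {n} H H′ ag S = bool-ext (half H H′ ag) (half H′ H (λ v v< → sym (ag v v<)))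
  where
  half : ∀ H H′ → Agree n (edges H) (edges H′) → edge H S ≡ true → edge H′ S ≡ true
  half H H′ ag e with refl ← uniform H S e = subst (λ S → edge H′ S ≡ true) set≡
      (present (edges⁻ H′ v (trans (sym (ag v (edges-bounded H v inH))) inH)))
    where
    v : Vec ℕ ∣ S ∣
    v = subst (Vec ℕ) (length-elements S) (fromList (elements S))
    v≡ : toList v ≡ elements S
    v≡ = trans (toList-subst (length-elements S)) (toList∘fromList (elements S))
      where
      toList-subst : ∀ {a b} (eq : a ≡ b) {w : Vec ℕ a} → toList (subst (Vec ℕ) eq w) ≡ toList w
      toList-subst refl = refl
    set≡ : toSet n (toList v) ≡ S
    set≡ = trans (cong (toSet n) v≡) (toSet-elements S)
    inH : edges H v ≡ true
    inH = edges⁺ H v (isEdge (subst Unique (sym v≡) (elements-Unique S)) (subst (All (_< n)) (sym v≡) (elements-< S))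
                             (trans (cong (edge H) set≡) e))

-- Encoding a relation by its peeled parts

removeAt-All : ∀ {s} {P : ℕ → Set} {v : Vec ℕ (suc s)} j → VAll P v → VAll P (lookup v j ∷ removeAt v j)
removeAt-All zero    (p ∷ ps) = p ∷ ps
removeAt-All {v = _ ∷ _ ∷ _} (suc j) (p ∷ ps@(_ ∷ _)) with p′ ∷ ps′ ← removeAt-All j ps = p′ ∷ p ∷ ps′

module PeelCode (b : ℕ) .{{_ : NonZero b}} {s : ℕ} (d K L : ℕ) where
  open Project b
  open Rainbow b {s}
  open Peel (b ^ L) d

  -- The relation is the union of its parts, one for each slot. In part `j`, slot `j` has bounded
  -- codegree; moved to the front it becomes the colour, and each part is coded separately from
  -- coarse to fine.
  Enc-peel : (P : X → Rel (suc s)) →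
             (∀ x v → P x v ≡ true → v ∈ vecs (b ^ L) (suc s)) → (∀ x → NoFull (P x)) →
             (∀ x j (A : Rel (suc s)) → (∀ z t → A (z ∷ t) ≡ true → P x (insertAt t j z) ≡ true) →
               ∀ i t (R : RainbowIn A i t) → 2 ^ i * ♯ (R .G) (vecs (b ^ i) s) ≤ K * (b ^ i) ^ s) →
             Enc X (λ a b → ∀ v → P a v ≡ P b v) (suc s * (suc (b ^ suc s * (d * K * (b ^ L) ^ s)) * 2))
  Enc-peel {X} P box nf rb = Enc-map together (Enc-∀ (suc s) {T = λ j x y → headed x j ≈[ b ^ L ] headed y j} λ j →
      Enc-list (λ x → code L (headed x j))
        (λ x → code-length L (headed x j) _ (rainbow⇒LevelBound (headed x j) L d (λ t → peel-insert (P x) j t) K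
                 (rb x j (headed x j) (λ z t → peel⊆ (P x) j (insertAt t j z)))))
        λ x y e → proj₁ (code-prefix L (headed x j) (headed y j) (cong (List._++ []) e)))
    where
    headed : X → Fin (suc s) → Rel (suc s)
    headed x j (z ∷ t) = peel (P x) j (insertAt t j z)
    half : ∀ x y → (∀ j → headed x j ≈[ b ^ L ] headed y j) → ∀ v → P x v ≡ true → P y v ≡ true
    half x y h v Pv =
      let j , e = peel-cover (P x) (box x) (nf x) v Pv
          back = insertAt-removeAt v j
      in peel⊆ (P y) j v (trans (cong (peel (P y) j) (sym back))
           (trans (sym (h j (lookup v j ∷ removeAt v j) (removeAt-All j (∈-vecs⁻ (box x v Pv)))))
             (trans (cong (peel (P x) j) back) e)))
    together : ∀ x y → (∀ j → headed x j ≈[ b ^ L ] headed y j) → ∀ v → P x v ≡ P y v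
    together x y h v = bool-ext (half x y h v) (half y x (λ j v v< → sym (h j v v<)) v)

-- Uniformity at least four

map-lookup-slots : ∀ {s} (e : Vec ℕ (3 + s)) → map (lookup e) (slots s) ≡ toList e
map-lookup-slots {s} e = begin
  map (lookup e) (toList (tabulate {n = 3 + s} id)) ≡⟨ toList-map (lookup e) (tabulate id) ⟨
  toList (Vec.map (lookup e) (tabulate id))         ≡⟨ cong toList (tabulate-∘ (lookup e) id) ⟨
  toList (tabulate (lookup e))                      ≡⟨ cong toList (tabulate∘lookup e) ⟩
  toList e                                          ∎
  where open ≡-Reasoning

toList-insertAt-↭ : ∀ {s} (t : Vec ℕ s) j z → toList (insertAt t j z) ↭ z ∷ toList t
toList-insertAt-↭ t       zero    z = ↭-refl
toList-insertAt-↭ (x ∷ t) (suc j) z = ↭-trans (Perm.prep x (toList-insertAt-↭ t j z)) (Perm.swap x z ↭-refl)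

Cycle : (E : List ℕ → Set) (s k : ℕ) → Set
Cycle E s k = ∃₂ λ v (bs : Vec (Vec ℕ (2 + s)) k) → Chain E v v bs × Unique (toList (concat bs))

noCycle : ∀ {s n k} (H : Forb (3 + s) n k) → Cycle (IsEdge (proj₁ H)) s k → ⊥
noCycle (H , free) (_ , _ , ch , u) = free (cycle⇒ContainsCycle H ch u)

module _ {s n q : ℕ} (H : Forb (3 + s) n (2 + q)) {m d : ℕ} where
  open Peel m d

  edges-NoFull : (3 + q) * (2 + (s + 0)) + (3 + q) * (2 + (s + 0)) < d → (P : Rel (3 + s)) →
                 (∀ v → P v ≡ true → edges (proj₁ H) v ≡ true) → NoFull P
  edges-NoFull large P P⊆ Q Q⊆ full v Qv = noCycle H (subst (λ h → Cycle (IsEdge (proj₁ H)) h (2 + q)) (+-identityʳ s)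
    (FullCycle.cycle {m = m} Q full (λ _ z → z) (λ _ e → e) (λ _ → []) (λ _ _ ()) (IsEdge (proj₁ H))
      (IsEdge-resp-↭ (proj₁ H)) distinct
      (λ {e} Qe → subst (IsEdge (proj₁ H)) (sym (trans (++-identityʳ _) (map-lookup-slots e))) (edges⁻ (proj₁ H) e (P⊆ e (Q⊆ e Qe))))
      large Qv))

module _ {s n q : ℕ} (H : Forb (4 + s) n (2 + q)) (b : ℕ) .{{_ : NonZero b}} where
  open Rainbow b {3 + s}

  -- The colour becomes one more private vertex of each edge, and being rainbow is exactly the
  -- disjointness demanded of attached vertices. The fan takes three slots besides the colour, which
  -- is where uniformity at least four enters.
  rainbow-NoFull : ∀ {d} → (3 + q) * (2 + (s + 1)) + (3 + q) * (2 + (s + 1)) < d → ∀ j (A : Rel (4 + s)) →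
                   (∀ z t → A (z ∷ t) ≡ true → edges (proj₁ H) (insertAt t j z) ≡ true) →
                   ∀ i t (R : RainbowIn A i t) → Peel.NoFull (b ^ i) d (R .G)
  rainbow-NoFull large j A A⊆ i t R Q Q⊆ full v Qv = noCycle H (subst (λ h → Cycle (IsEdge (proj₁ H)) h (2 + q)) (+-comm s 1)
    (FullCycle.cycle {m = b ^ i} Q full (λ σ z → lookup t σ * b ^ i + z) (λ σ → +-cancelˡ-≡ (lookup t σ * b ^ i) _ _)
      (λ w → R .colour w ∷ [])
      (λ { Qe Qe′ (here u≡) (here u≡′) → R .injective (Q⊆ _ Qe) (Q⊆ _ Qe′) (trans (sym u≡) u≡′) })
      (IsEdge (proj₁ H)) (IsEdge-resp-↭ (proj₁ H)) distinct (λ {e} Qe → isE e (R .member (Q⊆ e Qe))) large Qv))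
    where
    isE : ∀ e → A (R .colour e ∷ refine (b ^ i) t e) ≡ true →
          IsEdge (proj₁ H) (map (λ σ → lookup t σ * b ^ i + lookup e σ) (slots s) ++ R .colour e ∷ [])
    isE e Ae = subst (λ h → IsEdge (proj₁ H) (h ++ R .colour e ∷ [])) (sym eq)
      (IsEdge-resp-↭ (proj₁ H) (↭-trans (toList-insertAt-↭ v′ j (R .colour e)) (∷↭∷ʳ (R .colour e) (toList v′)))
        (edges⁻ (proj₁ H) (insertAt v′ j (R .colour e)) (A⊆ (R .colour e) v′ Ae)))
      where
      v′ = refine (b ^ i) t e
      eq : map (λ σ → lookup t σ * b ^ i + lookup e σ) (slots s) ≡ toList v′
      eq = trans (map-cong (λ σ → sym (lookup-zipWith _ σ t e)) (slots s)) (map-lookup-slots v′)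

  -- Sparsity gains a full factor `b ^ i` over the size of the box, and `2 ^ i ≤ b ^ i`.
  rainbow-bound : ∀ {d} → (3 + q) * (2 + (s + 1)) + (3 + q) * (2 + (s + 1)) < d → 2 ≤ b → ∀ j (A : Rel (4 + s)) →
                  (∀ z t → A (z ∷ t) ≡ true → edges (proj₁ H) (insertAt t j z) ≡ true) →
                  ∀ i t (R : RainbowIn A i t) → 2 ^ i * ♯ (R .G) (vecs (b ^ i) (3 + s)) ≤ ((3 + s) * d) * (b ^ i) ^ (3 + s)
  rainbow-bound {d} large 2≤b j A A⊆ i t R = begin
    2 ^ i * ♯ (R .G) (vecs (b ^ i) (3 + s))
      ≤⟨ *-monoʳ-≤ (2 ^ i) (Peel.NoFull⇒sparse (b ^ i) d (R .G) (λ v e → ∈-vecs⁺ (R .inBox e)) (rainbow-NoFull large j A A⊆ i t R)) ⟩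
    2 ^ i * ((3 + s) * ((b ^ i) ^ (2 + s) * d))
      ≤⟨ *-monoˡ-≤ _ (^-monoˡ-≤ i 2≤b) ⟩
    b ^ i * ((3 + s) * ((b ^ i) ^ (2 + s) * d))
      ≡⟨ eq (b ^ i) (3 + s) ((b ^ i) ^ (2 + s)) d ⟩
    ((3 + s) * d) * (b ^ i) ^ (3 + s) ∎
    where
    open ≤-Reasoning
    eq : ∀ q s p d → q * (s * (p * d)) ≡ (s * d) * (q * p)
    eq = solve-∀

-- Nested intervals need a range whose length is a power of `b`; rounding up to one costs a factor
-- of at most `b`.
powerAbove : ∀ b → 2 ≤ b → ∀ n → ∃ λ L → suc n ≤ b ^ L × b ^ L ≤ b * suc n
powerAbove b 2≤b zero = 0 , ≤-refl , ≤-trans (s≤s z≤n) (≤-trans 2≤b (≤-reflexive (sym (*-identityʳ b))))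
powerAbove b 2≤b (suc n) with L , lo , hi ← powerAbove b 2≤b n with 2 + n ≤? b ^ L
... | yes lo′ = L , lo′ , ≤-trans hi (*-monoʳ-≤ b (n≤1+n (suc n)))
... | no ≰ with e ← ≤-antisym (s≤s⁻¹ (≰⇒> ≰)) lo = suc L ,
      ≤-trans (s≤s (≤-trans (m≤n+m (suc n) n) (≤-reflexive (cong (n +_) (sym (+-identityʳ (suc n)))))))
        (≤-trans (*-monoˡ-≤ (suc n) 2≤b) (≤-reflexive (cong (b *_) (sym e)))) ,
      *-monoʳ-≤ b (≤-trans (≤-reflexive e) (n≤1+n (suc n)))

codeSize : (b s dK : ℕ) → ℕ
codeSize b s dK = suc s * (suc (b ^ suc s * (dK * b ^ s)) * 2)

codeSize-bound : ∀ b s dK n L → b ^ L ≤ b * suc n →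
                 suc s * (suc (b ^ suc s * (dK * (b ^ L) ^ s)) * 2) ≤ codeSize b s dK * suc n ^ s
codeSize-bound b s dK n L hi = begin
  suc s * (suc (β * (dK * (b ^ L) ^ s)) * 2)      ≤⟨ *-monoʳ-≤ (suc s) (*-monoˡ-≤ 2 (+-mono-≤ 1≤ (*-monoʳ-≤ β (*-monoʳ-≤ dK
                                                        (≤-trans (^-monoˡ-≤ s hi) (≤-reflexive (^-distribʳ b (suc n) s))))))) ⟩
  suc s * ((y + β * (dK * (b ^ s * y))) * 2)      ≡⟨ eq (suc s) y β dK (b ^ s) ⟩
  suc s * (suc (β * (dK * b ^ s)) * 2) * y        ∎
  where
  open ≤-Reasoning
  β = b ^ suc s
  y = suc n ^ s
  -- This absorbs the single bit of the coarsest level into the main term.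
  1≤ : 1 ≤ y
  1≤ = m^n>0 (suc n) s
  eq : ∀ s y B d p → s * ((y + B * (d * (p * y))) * 2) ≡ s * (suc (B * (d * p)) * 2) * y
  eq = solve-∀

VAll-mono : ∀ {s N N′} → N ≤ N′ → {v : Vec ℕ s} → VAll (_< N) v → VAll (_< N′) v
VAll-mono N≤ = VAll.map (λ x< → <-≤-trans x< N≤)

Enc-r≥4 : ∀ s q → ∃ λ C → ∀ n → Enc (Forb (4 + s) (suc n) (2 + q)) (λ a b → SameEdges (proj₁ a) (proj₁ b)) (C * suc n ^ (3 + s))
Enc-r≥4 s q = codeSize 2 (3 + s) (d * K) , λ n →
  let L , lo , hi = powerAbove 2 ≤-refl n
  in Enc-≤ (codeSize-bound 2 (3 + s) (d * K) n L hi)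
       (Enc-map (λ a b h → Agree⇒SameEdges (proj₁ a) (proj₁ b) (λ v _ → h v))
         (PeelCode.Enc-peel 2 d K L (λ H → edges (proj₁ H))
           (λ H v e → ∈-vecs⁺ (VAll-mono lo (edges-bounded (proj₁ H) v e)))
           (λ H → edges-NoFull H {2 ^ L} (s≤s (m≤m+n D₁ D₂)) (edges (proj₁ H)) (λ _ e → e))
           (λ H → rainbow-bound H 2 {d} (s≤s (m≤n+m D₂ D₁)) ≤-refl)))
  where
  -- `D₁` serves the hypergraph itself, with one more slot and no colour; `D₂` serves the rainbow
  -- systems. Their sum dominates both.
  D₁ = (3 + q) * (2 + (suc s + 0)) + (3 + q) * (2 + (suc s + 0))
  D₂ = (3 + q) * (2 + (s + 1)) + (3 + q) * (2 + (s + 1))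
  d = suc (D₁ + D₂)
  K = (3 + s) * d

-- Complete bipartite subgraphs

drop : ℕ → List ℕ → List ℕ
drop y = select (λ z → does (¬? (z ≟ y)))

drop-length : ∀ y C → length (drop y C) ≤ length C
drop-length y C = ≤-trans (≤-reflexive (length-select p C)) (♯≤length p C)
  where
  p : ℕ → Bool
  p z = does (¬? (z ≟ y))

♯-drop : (p : ℕ → Bool) (y : ℕ) {C : List ℕ} → Unique C → ♯ p C ≤ suc (♯ p (drop y C))
♯-drop p y [] = z≤n
♯-drop p y {z ∷ C} (z≢ ∷ u) with z ≡ᵇ y in eq
... | false = ≤-trans (+-monoʳ-≤ (ind (p z)) (♯-drop p y u)) (≤-reflexive (+-suc (ind (p z)) _))
... | true with refl ← does⇒ (z ≟ y) eq = +-mono-≤ (ind≤1 (p z)) (≤-reflexive (cong (♯ p) (sym (same C z≢))))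
  where
  ind≤1 : ∀ a → ind a ≤ 1
  ind≤1 true  = ≤-refl
  ind≤1 false = z≤n
  same : ∀ C → All (z ≢_) C → drop z C ≡ C
  same [] [] = refl
  same (w ∷ C) (z≢w ∷ a) with w ≡ᵇ z in eq
  ... | true  = contradiction (sym (does⇒ (w ≟ z) eq)) z≢w
  ... | false = cong (w ∷_) (same C a)

-- Every row of A has at least D + t ≥ q / S + t neighbours, so some column meets
-- at least |A| / S of the rows; restrict to these rows, delete the column and repeat.
commonNeighbours : (g : ℕ → ℕ → Bool) (q S D : ℕ) → q ≤ D * S → ∀ t (A C : List ℕ) →
  Unique A → Unique C → length C ≤ q → 0 < length A → (∀ {a} → a ∈ A → D + t ≤ ♯ (g a) C) →
  ∃₂ λ A′ Y → Unique A′ × Unique Y × length Y ≡ t × length A ≤ S ^ t * length A′ ×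
    (∀ {a} → a ∈ A′ → a ∈ A) × (∀ {y} → y ∈ Y → y ∈ C) × (∀ {a y} → a ∈ A′ → y ∈ Y → g a y ≡ true)
commonNeighbours g q S D q≤ zero A C uA uC C≤ A> deg =
  A , [] , uA , [] , refl , ≤-reflexive (sym (+-identityʳ _)) , (λ a∈ → a∈) , (λ ()) , λ _ ()
commonNeighbours g q S D q≤ (suc t) A [] uA uC C≤ A> deg with A
... | []    = contradiction A> λ ()
... | a ∷ _ = contradiction (≤-trans (≤-reflexive (sym (+-suc D t))) (deg (here refl))) λ ()
commonNeighbours g q S D q≤ (suc t) A C@(c ∷ C₀) uA uC C≤ A> deg =
  let A′ , Y , uA′ , uY , lenY , le , A′⊆ , Y⊆ , all = commonNeighbours g q S D q≤ t A₁ (drop y C)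
        (select-Unique (λ a → g a y) uA) (select-Unique _ uC)
        (≤-trans (drop-length y C) C≤) (positive A₁ S (≤-trans A> A≤))
        (λ a∈ → s≤s⁻¹ (≤-trans (≤-reflexive (sym (+-suc D t))) (≤-trans (deg (proj₁ (∈-select⁻ _ A a∈))) (♯-drop (g _) y uC))))
  in A′ , y ∷ Y , uA′ ,
     All.tabulate (λ z∈ y≡z → does⇒ (¬? (_ ≟ y)) (proj₂ (∈-select⁻ _ C (Y⊆ z∈))) (sym y≡z)) ∷ uY ,
     cong suc lenY ,
     ≤-trans A≤ (≤-trans (*-monoʳ-≤ S le) (≤-reflexive (sym (*-assoc S (S ^ t) (length A′))))) ,
     (λ a∈ → proj₁ (∈-select⁻ _ A (A′⊆ a∈))) ,
     (λ { (here refl) → y∈ ; (there z∈) → proj₁ (∈-select⁻ _ C (Y⊆ z∈)) }) ,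
     λ { a∈ (here refl) → proj₂ (∈-select⁻ _ A (A′⊆ a∈)) ; a∈ (there z∈) → all a∈ z∈ }
  where
  average : length C * length A ≤ ∑ C (λ y → S * ♯ (λ a → g a y) A)
  average = begin
    length C * length A                              ≤⟨ *-monoˡ-≤ (length A) (≤-trans C≤ q≤) ⟩
    (D * S) * length A                               ≡⟨ eq D S (length A) ⟩
    S * (length A * D)                               ≤⟨ *-monoʳ-≤ S (≤-trans (≤-reflexive (sym (∑-const A D)))
                                                          (∑-mono A (λ a∈ → ≤-trans (m≤m+n D (suc t)) (deg a∈)))) ⟩
    S * ∑ A (λ a → ♯ (g a) C)                        ≡⟨ cong (S *_) (∑-swap A C _) ⟩
    S * ∑ C (λ y → ♯ (λ a → g a y) A)                ≡⟨ ∑-*ˡ S C _ ⟩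
    ∑ C (λ y → S * ♯ (λ a → g a y) A)                ∎
    where
    open ≤-Reasoning
    eq : ∀ D S a → (D * S) * a ≡ S * (a * D)
    eq = solve-∀
  best = ∑-pigeon c C₀ (λ y → S * ♯ (λ a → g a y) A) (length A) average
  y = proj₁ best
  y∈ : y ∈ C
  y∈ = proj₁ (proj₂ best)
  A₁ = select (λ a → g a y) A
  A≤ : length A ≤ S * length A₁
  A≤ = ≤-trans (proj₂ (proj₂ best)) (≤-reflexive (cong (S *_) (sym (length-select _ A))))
  positive : ∀ (xs : List ℕ) S → 0 < S * length xs → 0 < length xs
  positive []      S lt = contradiction (≤-trans lt (≤-reflexive (*-zeroʳ S))) λ ()
  positive (_ ∷ _) S lt = s≤s z≤n

record Biclique (g : ℕ → ℕ → Bool) (q t : ℕ) : Set where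
  field
    rows cols   : List ℕ
    rows-unique : Unique rows
    cols-unique : Unique cols
    rows-length : t ≤ length rows
    cols-length : t ≤ length cols
    complete    : ∀ {a y} → a ∈ rows → y ∈ cols → g a y ≡ true

module KőváriSósTurán (t i : ℕ) (t>0 : 0 < t) (g : ℕ → ℕ → Bool) where

  private
    -- The side is `q = S₀ ^ (2 + t)`, so density `1 / S₀` equals q^(-1/(t+2)), which exceeds the
    -- critical q^(-1/t) for a biclique with `t` vertices on each side and leaves room for
    -- constants. `E = q / S₀` is the degree of a row of this density.
    S₀ = 2 ^ i
    E = S₀ ^ suc t
    q = (2 ^ (2 + t)) ^ i
    count = ∑ (upTo q) (λ a → ♯ (g a) (upTo q))

    q≡ : q ≡ S₀ * E
    q≡ = trans (^-*-assoc 2 (2 + t) i) (trans (cong (2 ^_) (*-comm (2 + t) i)) (sym (^-*-assoc 2 i (2 + t))))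

    high : ℕ → Bool
    high a = does (q ≤? S₀ * ♯ (g a) (upTo q))

    rows₀ = select high (upTo q)

    S₀>0 : 0 < S₀
    S₀>0 = m^n>0 2 i

    q>0 : 0 < q
    q>0 = m^n>0 (2 ^ (2 + t)) {{m^n≢0 2 (2 + t)}} i

    row-bound : ∀ a → S₀ * ♯ (g a) (upTo q) ≤ S₀ * q * ind (high a) + q
    row-bound a with high a in eq
    ... | true = ≤-trans (*-monoʳ-≤ S₀ (≤-trans (♯≤length (g a) (upTo q)) (≤-reflexive (length-upTo q))))
                    (≤-trans (≤-reflexive (sym (*-identityʳ (S₀ * q)))) (m≤m+n _ q))
    ... | false = ≤-trans (<⇒≤ (≰⇒> λ le → contradiction (trans (sym (dec-true (q ≤? S₀ * ♯ (g a) (upTo q)) le)) eq) λ ())) (m≤n+m q _)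

    count-bound : S₀ * count ≤ S₀ * q * length rows₀ + q * q
    count-bound = begin
      S₀ * count                                             ≡⟨ ∑-*ˡ S₀ (upTo q) _ ⟩
      ∑ (upTo q) (λ a → S₀ * ♯ (g a) (upTo q))               ≤⟨ ∑-mono (upTo q) (λ {a} _ → row-bound a) ⟩
      ∑ (upTo q) (λ a → S₀ * q * ind (high a) + q)           ≡⟨ ∑-+ (upTo q) _ _ ⟩
      ∑ (upTo q) (λ a → S₀ * q * ind (high a)) + ∑ (upTo q) (λ _ → q)
        ≡⟨ cong₂ _+_ (trans (sym (∑-*ˡ (S₀ * q) (upTo q) _)) (cong (S₀ * q *_) (sym (length-select high (upTo q)))))
                     (trans (∑-const (upTo q) q) (cong (_* q) (length-upTo q))) ⟩
      S₀ * q * length rows₀ + q * q                          ∎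
      where open ≤-Reasoning

  dense⇒biclique : t * 2 ^ t ≤ 2 ^ i → 2 * (q * q) ≤ 2 ^ i * count → Biclique g q t
  dense⇒biclique t≤ dense =
    let A′ , Y , uA′ , uY , lenY , le , _ , _ , all =
          -- With `D = E ∸ t` a row of degree `E` can afford to lose `t` columns. Since `t` is at
          -- most half of `E`, doubling `S₀` makes up for the smaller `D`.
          commonNeighbours g q (2 * S₀) (E ∸ t) D≥ t rows₀ (upTo q) (select-Unique high (Uniqueₚ.upTo⁺ q)) (Uniqueₚ.upTo⁺ q)
            (≤-reflexive (length-upTo q)) (≤-trans E>0 E≤) degree
    in record { rows = A′ ; cols = Y ; rows-unique = uA′ ; cols-unique = uY
              ; rows-length = enough le ; cols-length = ≤-reflexive (sym lenY) ; complete = all }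
    where
    open ≤-Reasoning
    E>0 : 0 < E
    E>0 = m^n>0 S₀ {{m^n≢0 2 i}} (suc t)
    q≤ : q ≤ S₀ * length rows₀
    q≤ = *-cancelʳ-≤ _ _ q {{>-nonZero q>0}} (+-cancelʳ-≤ (q * q) _ _ (begin
      q * q + q * q                          ≡⟨ cong (q * q +_) (sym (+-identityʳ (q * q))) ⟩
      2 * (q * q)                            ≤⟨ dense ⟩
      S₀ * count                             ≤⟨ count-bound ⟩
      S₀ * q * length rows₀ + q * q          ≡⟨ cong (_+ q * q) (eq S₀ q (length rows₀)) ⟩
      S₀ * length rows₀ * q + q * q          ∎))
      where
      eq : ∀ a b c → a * b * c ≡ a * c * b
      eq = solve-∀
    E≤ : E ≤ length rows₀
    E≤ = *-cancelˡ-≤ S₀ {{>-nonZero S₀>0}} (≤-trans (≤-reflexive (sym q≡)) q≤)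
    2t≤ : t + t ≤ E
    2t≤ = begin
      t + t              ≡⟨ eq t ⟩
      t * 2              ≤⟨ *-monoʳ-≤ t (^-monoʳ-≤ 2 {1} t>0) ⟩
      t * 2 ^ t          ≤⟨ t≤ ⟩
      S₀                 ≡⟨ sym (*-identityʳ S₀) ⟩
      S₀ * 1             ≤⟨ *-monoʳ-≤ S₀ (m^n>0 S₀ {{m^n≢0 2 i}} t) ⟩
      S₀ ^ suc t         ∎
      where
      eq : ∀ t → t + t ≡ t * 2
      eq = solve-∀
    t≤E : t ≤ E
    t≤E = ≤-trans (m≤m+n t t) 2t≤
    E≤2D : E ≤ 2 * (E ∸ t)
    E≤2D = begin
      E                    ≡⟨ sym (m∸n+n≡m t≤E) ⟩
      E ∸ t + t            ≤⟨ +-monoʳ-≤ (E ∸ t) (m+n≤o⇒m≤o∸n t 2t≤) ⟩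
      E ∸ t + (E ∸ t)      ≡⟨ cong (E ∸ t +_) (sym (+-identityʳ _)) ⟩
      2 * (E ∸ t)          ∎
    D≥ : q ≤ (E ∸ t) * (2 * S₀)
    D≥ = begin
      q                        ≡⟨ q≡ ⟩
      S₀ * E                   ≤⟨ *-monoʳ-≤ S₀ E≤2D ⟩
      S₀ * (2 * (E ∸ t))       ≡⟨ eq S₀ (E ∸ t) ⟩
      (E ∸ t) * (2 * S₀)       ∎
      where
      eq : ∀ a b → a * (2 * b) ≡ b * (2 * a)
      eq = solve-∀
    degree : ∀ {a} → a ∈ rows₀ → E ∸ t + t ≤ ♯ (g a) (upTo q)
    degree {a} a∈ = ≤-trans (≤-reflexive (m∸n+n≡m t≤E)) (*-cancelˡ-≤ S₀ {{>-nonZero S₀>0}}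
      (≤-trans (≤-reflexive (sym q≡)) (does⇒ (q ≤? S₀ * ♯ (g a) (upTo q)) (proj₂ (∈-select⁻ high (upTo q) a∈)))))
    -- At least `S₀ ^ suc t` rows shrink by a factor of at most `(2 * S₀) ^ t`, so at least
    -- `S₀ / 2 ^ t` survive, and this is at least `t`.
    enough : ∀ {l} → length rows₀ ≤ (2 * S₀) ^ t * l → t ≤ l
    enough {l} le = *-cancelˡ-≤ (2 ^ t) {{m^n≢0 2 t}} (*-cancelˡ-≤ (S₀ ^ t) {{m^n≢0 S₀ t {{m^n≢0 2 i}}}} (begin
      S₀ ^ t * (2 ^ t * t)       ≡⟨ cong (S₀ ^ t *_) (*-comm (2 ^ t) t) ⟩
      S₀ ^ t * (t * 2 ^ t)       ≤⟨ *-monoʳ-≤ (S₀ ^ t) t≤ ⟩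
      S₀ ^ t * S₀                ≡⟨ *-comm (S₀ ^ t) S₀ ⟩
      E                          ≤⟨ E≤ ⟩
      length rows₀               ≤⟨ le ⟩
      (2 * S₀) ^ t * l           ≡⟨ cong (_* l) (trans (^-distribʳ 2 S₀ t) (*-comm (2 ^ t) (S₀ ^ t))) ⟩
      S₀ ^ t * 2 ^ t * l         ≡⟨ *-assoc (S₀ ^ t) (2 ^ t) l ⟩
      S₀ ^ t * (2 ^ t * l)       ∎))

  -- The summand `t * 2 ^ t` covers the small levels, where the trivial count `q * q` is good
  -- enough; the summand 2 is the density at which the larger levels produce a biclique.
  sparse∨biclique : (2 ^ i * count ≤ (t * 2 ^ t + 2) * (q * q)) ⊎ Biclique g q t
  sparse∨biclique with t * 2 ^ t ≤? 2 ^ i | 2 * (q * q) ≤? 2 ^ i * count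
  ... | yes t≤ | yes dense = inj₂ (dense⇒biclique t≤ dense)
  ... | _      | no sparse = inj₁ (≤-trans (<⇒≤ (≰⇒> sparse)) (*-monoˡ-≤ (q * q) (m≤n+m 2 (t * 2 ^ t))))
  ... | no t≰  | yes _     = inj₁ (*-mono-≤ (≤-trans (<⇒≤ (≰⇒> t≰)) (m≤m+n _ 2)) (begin
        count                          ≤⟨ ∑-mono (upTo q) (λ {a} _ → ≤-trans (♯≤length (g a) (upTo q)) (≤-reflexive (length-upTo q))) ⟩
        ∑ (upTo q) (λ _ → q)           ≡⟨ trans (∑-const (upTo q) q) (cong (_* q) (length-upTo q)) ⟩
        q * q                          ∎))
    where open ≤-Reasoning

-- Triple systems

∃<? : ∀ n {P : ℕ → Set} → (∀ z → Dec (P z)) → (∀ {z} → P z → z < n) → Dec (∃ P)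
∃<? n P? bound = map′ (λ a → let z , _ , p = find a in z , p) (λ (z , p) → lose (∈-upTo⁺ (bound p)) p) (any? P? (upTo n))

toList-concat-++ : ∀ {m k k′} (bs : Vec (Vec ℕ m) k) (cs : Vec (Vec ℕ m) k′) →
                   toList (concat (bs Vec.++ cs)) ≡ toList (concat bs) ++ toList (concat cs)
toList-concat-++ []       cs = refl
toList-concat-++ (b ∷ bs) cs = begin
  toList (concat (b ∷ bs Vec.++ cs))                          ≡⟨ toList-concat b (bs Vec.++ cs) ⟩
  toList b ++ toList (concat (bs Vec.++ cs))                  ≡⟨ cong (toList b ++_) (toList-concat-++ bs cs) ⟩
  toList b ++ (toList (concat bs) ++ toList (concat cs))      ≡⟨ sym (++-assoc (toList b) _ _) ⟩
  (toList b ++ toList (concat bs)) ++ toList (concat cs)      ≡⟨ cong (_++ toList (concat cs)) (sym (toList-concat b bs)) ⟩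
  toList (concat (b ∷ bs)) ++ toList (concat cs)              ∎
  where open ≡-Reasoning

module Triple {n : ℕ} (H : RGraph 3 n) where

  E : ℕ → ℕ → ℕ → Set
  E x y z = IsEdge H (x ∷ y ∷ z ∷ [])

  E? : ∀ x y z → Dec (E x y z)
  E? x y z = isEdge? H (x ∷ y ∷ z ∷ [])

  swap₁₂ : ∀ {x y z} → E x y z → E y x z
  swap₁₂ = IsEdge-resp-↭ H (Perm.swap _ _ ↭-refl)

  swap₂₃ : ∀ {x y z} → E x y z → E x z y
  swap₂₃ = IsEdge-resp-↭ H (Perm.prep _ (Perm.swap _ _ ↭-refl))

  E-<₁ : ∀ {x y z} → E x y z → x < n
  E-<₁ e with a ∷ _ ← inRange e = a

  E-<₂ : ∀ {x y z} → E x y z → y < n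
  E-<₂ e = E-<₁ (swap₁₂ e)

  E-<₃ : ∀ {x y z} → E x y z → z < n
  E-<₃ e = E-<₂ (swap₂₃ e)

  E-≢₁₂ : ∀ {x y z} → E x y z → x ≢ y
  E-≢₁₂ e with (a ∷ _) ∷ _ ← distinct e = a

  E-≢₁₃ : ∀ {x y z} → E x y z → x ≢ z
  E-≢₁₃ e = E-≢₁₂ (swap₂₃ e)

  E-≢₂₃ : ∀ {x y z} → E x y z → y ≢ z
  E-≢₂₃ e = E-≢₁₃ (swap₁₂ e)

  -- `Path l` has l + 1 edges.
  Path : ℕ → List ℕ → ℕ → ℕ → Set
  Path zero    F x y = ∃ λ z → z ∉ F × E y x z
  Path (suc l) F x y = ∃ λ p → p ∉ F × ∃ λ z → z ∉ F × E p x z × Path l (p ∷ z ∷ F) p y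

  path? : ∀ l F x y → Dec (Path l F x y)
  path? zero    F x y = ∃<? n (λ z → ¬? (z ∈? F) ×-dec E? y x z) (λ (_ , e) → E-<₃ e)
  path? (suc l) F x y =
    ∃<? n (λ p → ¬? (p ∈? F) ×-dec
      ∃<? n (λ z → ¬? (z ∈? F) ×-dec (E? p x z ×-dec path? l (p ∷ z ∷ F) p y)) (λ (_ , e , _) → E-<₃ e))
      (λ (_ , _ , _ , e , _) → E-<₁ e)

  PathBlocks : ℕ → List ℕ → ℕ → ℕ → Set
  PathBlocks l F x y = ∃ λ (bs : Vec (Vec ℕ 2) (suc l)) → Chain (IsEdge H) x y bs ×
    Unique (toList (concat bs)) × (∀ {u} → u ∈ toList (concat bs) → u ≡ x ⊎ u ∉ F)

  path⇒chain : ∀ l {F x y} → x ∈ F → Path l F x y → PathBlocks l F x y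
  path⇒chain zero {x = x} x∈ (z , z∉ , e) =
    (x ∷ z ∷ []) ∷ [] , last e , (E-≢₂₃ e ∷ []) ∷ [] ∷ [] ,
    λ { (here e) → inj₁ e ; (there (here refl)) → inj₂ z∉ }
  path⇒chain (suc l) {F} {x} {y} x∈ (p , p∉ , z , z∉ , e , path) = assemble (path⇒chain l (here refl) path)
    where
    assemble : PathBlocks l (p ∷ z ∷ F) p y → PathBlocks (suc l) F x y
    assemble (bs , ch , u , new) = (x ∷ z ∷ []) ∷ bs , step e ch , (ux ∷ uz ∷ u) , old
      where
      ux : All (x ≢_) (z ∷ toList (concat bs))
      ux = E-≢₂₃ e ∷ All.tabulate λ v∈ → λ { refl → case (new v∈) }
        where case : x ≡ p ⊎ x ∉ p ∷ z ∷ F → ⊥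
              case (inj₁ x≡p) = E-≢₁₂ e (sym x≡p)
              case (inj₂ x∉)  = x∉ (there (there x∈))
      uz : All (z ≢_) (toList (concat bs))
      uz = All.tabulate λ v∈ → λ { refl → case (new v∈) }
        where case : z ≡ p ⊎ z ∉ p ∷ z ∷ F → ⊥
              case (inj₁ z≡p) = E-≢₁₃ e (sym z≡p)
              case (inj₂ z∉)  = z∉ (there (here refl))
      old : ∀ {v} → v ∈ x ∷ z ∷ toList (concat bs) → v ≡ x ⊎ v ∉ F
      old (here e) = inj₁ e
      old (there (here refl)) = inj₂ z∉
      old (there (there v∈)) with new v∈
      ... | inj₁ refl = inj₂ p∉
      ... | inj₂ v∉   = inj₂ (v∉ ∘ there ∘ there)

  -- The avoided `a`, `b`, `c` are room for the three vertices of a closing detour. They range over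
  -- a list, which keeps the property decidable.
  Robust : ℕ → ℕ → ℕ → Set
  Robust l x y = All (λ a → All (λ b → All (λ c → Path l (x ∷ y ∷ a ∷ b ∷ c ∷ []) x y) (upTo n)) (upTo n)) (upTo n)

  robust? : ∀ l x y → Dec (Robust l x y)
  robust? l x y = all? (λ a → all? (λ b → all? (λ c → path? l _ x y) (upTo n)) (upTo n)) (upTo n)

  -- Admitting both directions makes this symmetric without reversing paths.
  Linked : ℕ → ℕ → ℕ → Set
  Linked l x y = x ≢ y × (Robust l x y ⊎ Robust l y x)

  linked? : ∀ l x y → Dec (Linked l x y)
  linked? l x y = ¬? (x ≟ y) ×-dec (robust? l x y ⊎-dec robust? l y x)

  Linked-sym : ∀ {l x y} → Linked l x y → Linked l y x
  Linked-sym (ne , r) = (ne ∘ sym) , swap r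

  robust⇒chain : ∀ {l x y} → Robust l x y → ∀ {a b c} → a < n → b < n → c < n → PathBlocks l (x ∷ y ∷ a ∷ b ∷ c ∷ []) x y
  robust⇒chain {l} r a< b< c< =
    path⇒chain l (here refl) (All.lookup (All.lookup (All.lookup r (∈-upTo⁺ a<)) (∈-upTo⁺ b<)) (∈-upTo⁺ c<))

  closeCycle : ∀ {l j x y F} {cs : Vec (Vec ℕ 2) j} → PathBlocks l F x y → Chain (IsEdge H) y x cs →
               Unique (toList (concat cs)) → (∀ {u} → u ∈ toList (concat cs) → u ≢ x × u ∈ F) → Cycle (IsEdge H) 0 (suc l + j)
  closeCycle {x = x} {cs = cs} (bs , ch , u , new) ch′ u′ old =
    _ , bs Vec.++ cs , ch ⟫ ch′ , subst Unique (sym (toList-concat-++ bs cs)) (Uniqueₚ.++⁺ u u′ λ (p , q) → disj (new p) (old q))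
    where
    disj : ∀ {v F} → v ≡ x ⊎ v ∉ F → v ≢ x × v ∈ F → ⊥
    disj (inj₁ e) (ne , _)  = ne e
    disj (inj₂ v∉) (_ , v∈) = v∉ v∈

  robust-edge⇒cycle : ∀ {l x y z} → Robust l x y → E x y z → Cycle (IsEdge H) 0 (suc l + 1)
  robust-edge⇒cycle {y = y} {z} r e =
    closeCycle {cs = (y ∷ z ∷ []) ∷ []} (robust⇒chain r (E-<₃ e) (E-<₃ e) (E-<₃ e)) (last e)
      ((E-≢₂₃ e ∷ []) ∷ [] ∷ [])
      λ { (here refl) → (E-≢₁₂ e ∘ sym) , there (here refl)
        ; (there (here refl)) → (E-≢₁₃ e ∘ sym) , there (there (here refl)) }

  -- The edges `z y x′` and `x z y′` lead from `y` to `x` with joint `z`; a robust path that avoids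
  -- `z`, `x′` and `y′` closes them to a cycle of `l + 3` edges.
  robust-detour⇒cycle : ∀ {l x y z x′ y′} → x ≢ y → Robust l x y → E z y x′ → E x z y′ → x′ ≢ x → y′ ≢ y → x′ ≢ y′ →
                        Cycle (IsEdge H) 0 (suc l + 2)
  robust-detour⇒cycle {x = x} {y} {z} {x′} {y′} x≢y r e e′ x′≢x y′≢y x′≢y′ =
    closeCycle {cs = (y ∷ x′ ∷ []) ∷ (z ∷ y′ ∷ []) ∷ []} (robust⇒chain r (E-<₁ e) (E-<₃ e) (E-<₃ e′))
      (step e (last e′))
      ((E-≢₂₃ e ∷ (E-≢₁₂ e ∘ sym) ∷ (y′≢y ∘ sym) ∷ []) ∷ ((E-≢₁₃ e ∘ sym) ∷ x′≢y′ ∷ []) ∷ (E-≢₂₃ e′ ∷ []) ∷ [] ∷ [])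
      λ { (here refl) → (x≢y ∘ sym) , there (here refl)
        ; (there (here refl)) → x′≢x , there (there (there (here refl)))
        ; (there (there (here refl))) → (E-≢₁₂ e′ ∘ sym) , there (there (here refl))
        ; (there (there (there (here refl)))) → (E-≢₁₃ e′ ∘ sym) , there (there (there (there (here refl)))) }

  module RainbowBiclique
    (I J : List ℕ) (uI : Unique I) (uJ : Unique J) (fx fy : ℕ → ℕ)
    (fx-inj : ∀ {a b} → fx a ≡ fx b → a ≡ b) (fy-inj : ∀ {a b} → fy a ≡ fy b → a ≡ b)
    (col : ℕ → ℕ → ℕ) (col-inj : ∀ {i i′ j j′} → i ∈ I → i′ ∈ I → j ∈ J → j′ ∈ J → col i j ≡ col i′ j′ → i ≡ i′ × j ≡ j′)
    (isE : ∀ {i j} → i ∈ I → j ∈ J → E (fx i) (fy j) (col i j))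
    {j₀ : ℕ} (j₀∈ : j₀ ∈ J) where

    pickJ : ∀ {i} → i ∈ I → ∀ F → length F + length F < length J → ∃ λ j → j ∈ J × fy j ∉ F × col i j ∉ F
    pickJ {i} i∈ F F< =
      let j , j∈ , ok = avoid Kill? J uJ (map inj₁ F ++ map inj₂ F) inj
            (subst (_< length J) (sym (trans (length-++ (map inj₁ F)) (cong₂ _+_ (length-map inj₁ F) (length-map inj₂ F)))) F<)
      in j , j∈ , (λ u∈ → ok (∈-++⁺ˡ (∈-map⁺ inj₁ u∈)) refl) , λ u∈ → ok (∈-++⁺ʳ (map inj₁ F) (∈-map⁺ inj₂ u∈)) refl
      where
      Kill : ℕ → ℕ ⊎ ℕ → Set
      Kill j (inj₁ u) = fy j ≡ u
      Kill j (inj₂ u) = col i j ≡ u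
      Kill? : ∀ j u → Dec (Kill j u)
      Kill? j (inj₁ u) = fy j ≟ u
      Kill? j (inj₂ u) = col i j ≟ u
      inj : ∀ {j j′ u} → j ∈ J → j′ ∈ J → Kill j u → Kill j′ u → j ≡ j′
      inj {u = inj₁ _} _ _ a b = fy-inj (trans a (sym b))
      inj {u = inj₂ _} j∈ j′∈ a b = proj₂ (col-inj i∈ i∈ j∈ j′∈ (trans a (sym b)))

    -- Besides the new vertex and its colour towards `j`, the colour towards `j₀` is kept free too,
    -- for the edge that may end the path. So each forbidden vertex excludes up to three candidates.
    pickI : ∀ {j} → j ∈ J → ∀ F → length F + (length F + length F) < length I →
            ∃ λ i → i ∈ I × fx i ∉ F × col i j ∉ F × col i j₀ ∉ F
    pickI {j} j∈ F F< =
      let i , i∈ , ok = avoid Kill? I uI (map inj₁ F ++ map inj₂ (map inj₁ F ++ map inj₂ F)) inj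
            (subst (_< length I) (sym len) F<)
      in i , i∈ , (λ u∈ → ok (∈-++⁺ˡ (∈-map⁺ inj₁ u∈)) refl) ,
         (λ u∈ → ok (∈-++⁺ʳ (map inj₁ F) (∈-map⁺ inj₂ (∈-++⁺ˡ (∈-map⁺ inj₁ u∈)))) refl) ,
         λ u∈ → ok (∈-++⁺ʳ (map inj₁ F) (∈-map⁺ inj₂ (∈-++⁺ʳ (map inj₁ F) (∈-map⁺ inj₂ u∈)))) refl
      where
      len : length (map {B = ℕ ⊎ (ℕ ⊎ ℕ)} inj₁ F ++ map inj₂ (map inj₁ F ++ map inj₂ F)) ≡ length F + (length F + length F)
      len = trans (length-++ (map inj₁ F)) (cong₂ _+_ (length-map inj₁ F)
              (trans (length-map inj₂ (map inj₁ F ++ map inj₂ F))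
                (trans (length-++ (map inj₁ F)) (cong₂ _+_ (length-map inj₁ F) (length-map inj₂ F)))))
      Kill : ℕ → ℕ ⊎ (ℕ ⊎ ℕ) → Set
      Kill i (inj₁ u) = fx i ≡ u
      Kill i (inj₂ (inj₁ u)) = col i j ≡ u
      Kill i (inj₂ (inj₂ u)) = col i j₀ ≡ u
      Kill? : ∀ i u → Dec (Kill i u)
      Kill? i (inj₁ u) = fx i ≟ u
      Kill? i (inj₂ (inj₁ u)) = col i j ≟ u
      Kill? i (inj₂ (inj₂ u)) = col i j₀ ≟ u
      inj : ∀ {i i′ u} → i ∈ I → i′ ∈ I → Kill i u → Kill i′ u → i ≡ i′
      inj {u = inj₁ _} _ _ a b = fx-inj (trans a (sym b))
      inj {u = inj₂ (inj₁ _)} i∈ i′∈ a b = proj₁ (col-inj i∈ i′∈ j∈ j∈ (trans a (sym b)))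
      inj {u = inj₂ (inj₂ _)} i∈ i′∈ a b = proj₁ (col-inj i∈ i′∈ j₀∈ j₀∈ (trans a (sym b)))

    -- The path zigzags between the sides. Each round spends two edges and four new vertices,
    -- `m + 1` rounds are made, and a last edge goes to `j₀`. The length bounds are the forbidden
    -- vertices, three exclusions each.
    oddPath : ∀ m F {i} → i ∈ I → fy j₀ ∈ F → (length F + suc m * 4) * 3 ≤ length I → (length F + suc m * 4) * 3 ≤ length J →
              Path (2 + m * 2) F (fx i) (fy j₀)
    oddPath m F {i} i∈ y₀∈ leI leJ =
      fy j , fy∉ , col i j , col∉ , swap₁₂ (isE i∈ j∈) ,
      fx i′ , fx∉ , col i′ j , col′∉ , isE i′∈ j∈ , finish m leI leJ
      where
      bound : ∀ a m → suc (suc (suc a) + (suc (suc a) + suc (suc a))) ≤ (a + suc m * 4) * 3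
      bound a m = ≤-trans (m≤m+n _ (5 + m * 12)) (≤-reflexive (eq a m))
        where
        eq : ∀ a m → suc (suc (suc a) + (suc (suc a) + suc (suc a))) + (5 + m * 12) ≡ (a + suc m * 4) * 3
        eq = solve-∀
      a = length F
      pj = pickJ i∈ F (≤-trans (≤-trans (s≤s (+-mono-≤ (m≤n+m a 2) (≤-trans (m≤n+m a 2) (m≤m+n (2 + a) (2 + a))))) (bound a m)) leJ)
      j = proj₁ pj
      j∈ : j ∈ J
      j∈ = proj₁ (proj₂ pj)
      fy∉ : fy j ∉ F
      fy∉ = proj₁ (proj₂ (proj₂ pj))
      col∉ : col i j ∉ F
      col∉ = proj₂ (proj₂ (proj₂ pj))
      F₁ = fy j ∷ col i j ∷ F
      pi = pickI j∈ F₁ (≤-trans (bound a m) leI)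
      i′ = proj₁ pi
      i′∈ : i′ ∈ I
      i′∈ = proj₁ (proj₂ pi)
      fx∉ : fx i′ ∉ F₁
      fx∉ = proj₁ (proj₂ (proj₂ pi))
      col′∉ : col i′ j ∉ F₁
      col′∉ = proj₁ (proj₂ (proj₂ (proj₂ pi)))
      col₀∉ : col i′ j₀ ∉ F₁
      col₀∉ = proj₂ (proj₂ (proj₂ (proj₂ pi)))
      F₂ = fx i′ ∷ col i′ j ∷ F₁
      grow : ∀ a m → (4 + a + suc m * 4) * 3 ≡ (a + suc (suc m) * 4) * 3
      grow = solve-∀
      finish : ∀ m → (a + suc m * 4) * 3 ≤ length I → (a + suc m * 4) * 3 ≤ length J → Path (m * 2) F₂ (fx i′) (fy j₀)
      finish zero _ _ = col i′ j₀ , fresh , swap₁₂ (isE i′∈ j₀∈)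
        where
        fresh : col i′ j₀ ∉ F₂
        fresh (here e) = E-≢₁₃ (isE i′∈ j₀∈) (sym e)
        -- Equal colours would give `j ≡ j₀`, whereas `fy j` avoids `F` and `fy j₀` lies in it.
        fresh (there (here e)) = fy∉ (subst (λ h → fy h ∈ F) (proj₂ (col-inj i′∈ i′∈ j₀∈ j∈ e)) y₀∈)
        fresh (there (there u∈)) = col₀∉ u∈
      finish (suc m) leI leJ = oddPath m F₂ i′∈ (there (there (there (there y₀∈))))
        (≤-trans (≤-reflexive (grow a m)) leI) (≤-trans (≤-reflexive (grow a m)) leJ)

    robust : ∀ m {i} → i ∈ I → (5 + suc m * 4) * 3 ≤ length I → (5 + suc m * 4) * 3 ≤ length J → Robust (2 + m * 2) (fx i) (fy j₀)
    robust m i∈ leI leJ = All.tabulate λ _ → All.tabulate λ _ → All.tabulate λ _ → oddPath m _ i∈ (there (here refl)) leI leJ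

-- Edges without a linked pair

module Bad {n : ℕ} (H : RGraph 3 n) (l : ℕ) where
  open Triple H

  IsBad : ℕ → ℕ → ℕ → Set
  IsBad x y z = E x y z × ¬ Linked l x y × ¬ Linked l x z × ¬ Linked l y z

  isBad? : ∀ x y z → Dec (IsBad x y z)
  isBad? x y z = E? x y z ×-dec (¬? (linked? l x y) ×-dec (¬? (linked? l x z) ×-dec ¬? (linked? l y z)))

  bad : Rel 3
  bad (x ∷ y ∷ z ∷ []) = does (isBad? x y z)

  bad⁻ : ∀ {x y z} → bad (x ∷ y ∷ z ∷ []) ≡ true → IsBad x y z
  bad⁻ {x} {y} {z} = does⇒ (isBad? x y z)

  bad⁺ : ∀ {x y z} → IsBad x y z → bad (x ∷ y ∷ z ∷ []) ≡ true
  bad⁺ {x} {y} {z} = dec-true (isBad? x y z)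

  bad⊆edges : ∀ v → bad v ≡ true → edges H v ≡ true
  bad⊆edges v@(x ∷ y ∷ z ∷ []) e = edges⁺ H v (proj₁ (bad⁻ e))

  bad-pair : ∀ j x y c → bad (insertAt (x ∷ y ∷ []) j c) ≡ true → E x y c × ¬ Linked l x y
  bad-pair zero             x y c e = let h , _ , _ , ¬l = bad⁻ e in swap₂₃ (swap₁₂ h) , ¬l
  bad-pair (suc zero)       x y c e = let h , _ , ¬l , _ = bad⁻ e in swap₂₃ h , ¬l
  bad-pair (suc (suc zero)) x y c e = let h , ¬l , _ , _ = bad⁻ e in h , ¬l

-- Abstract, so that 2 ^ bicliqueSize m is not unfolded.
abstract
  bicliqueSize : ℕ → ℕ
  bicliqueSize m = (5 + suc m * 4) * 3

  bicliqueSize-≥ : ∀ m → (5 + suc m * 4) * 3 ≤ bicliqueSize m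
  bicliqueSize-≥ m = ≤-refl

bicliqueSize>0 : ∀ m → 0 < bicliqueSize m
bicliqueSize>0 m = ≤-trans (s≤s z≤n) (bicliqueSize-≥ m)

-- With this base the side of a box at level `i` is the one for which excluding a biclique saves the
-- factor `2 ^ i`.
base : ℕ → ℕ
base m = 2 ^ (2 + bicliqueSize m)

instance
  base-nonZero : ∀ {m} → NonZero (base m)
  base-nonZero {m} = m^n≢0 2 (2 + bicliqueSize m)

2≤base : ∀ m → 2 ≤ base m
2≤base m = ^-monoʳ-≤ 2 {1} {2 + bicliqueSize m} (s≤s z≤n)

sparsity : ℕ → ℕ
sparsity m = bicliqueSize m * 2 ^ bicliqueSize m + 2

firstOf : (xs : List ℕ) → 0 < length xs → ∃ λ x → x ∈ xs
firstOf (x ∷ _) _ = x , here refl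

♯-vecs-2 : ∀ q (G : Rel 2) → ♯ G (vecs q 2) ≡ ∑ (upTo q) (λ a → ♯ (λ z → G (z ∷ a ∷ [])) (upTo q))
♯-vecs-2 q G = trans (∑-vecs-suc q 1 _) (trans (∑-vecs-suc q 0 _) (+-identityʳ _))

module _ {n : ℕ} (H : RGraph 3 n) (m : ℕ) where
  open Triple H
  open Bad H (2 + m * 2)
  open Rainbow (base m) {2}

  -- A biclique would provide robust paths of `3 + m * 2` edges between its sides, and so would link
  -- two vertices of a bad edge.
  bad-rainbow-bound : ∀ j (A : Rel 3) → (∀ z t → A (z ∷ t) ≡ true → bad (insertAt t j z) ≡ true) →
                      ∀ i t (R : RainbowIn A i t) → 2 ^ i * ♯ (R .G) (vecs (base m ^ i) 2) ≤ sparsity m * (base m ^ i) ^ 2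
  bad-rainbow-bound j A A⊆ i (t₀ ∷ t₁ ∷ []) R
    -- The columns carry the first coordinate, because the sum over `vecs` has the head innermost.
    with KőváriSósTurán.sparse∨biclique (bicliqueSize m) i (bicliqueSize>0 m) (λ a z → R .G (z ∷ a ∷ []))
  ... | inj₁ sparse = subst₂ (λ c q → 2 ^ i * c ≤ sparsity m * q) (sym (♯-vecs-2 (base m ^ i) (R .G)))
          (cong (base m ^ i *_) (sym (*-identityʳ (base m ^ i)))) sparse
  ... | inj₂ K = ⊥-elim (proj₂ (pair i₀∈ j₀∈) (E-≢₁₂ (proj₁ (pair i₀∈ j₀∈)) ,
          inj₁ (RainbowBiclique.robust cols rows cols-unique rows-unique fx fy
            (+-cancelˡ-≡ (t₀ * q) _ _) (+-cancelˡ-≡ (t₁ * q) _ _)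
            (λ i j → R .colour (i ∷ j ∷ []))
            (λ i∈ i′∈ j∈ j′∈ e → split (R .injective (complete j∈ i∈) (complete j′∈ i′∈) e))
            (λ i∈ j∈ → proj₁ (pair i∈ j∈)) j₀∈ m i₀∈ (≤-trans (bicliqueSize-≥ m) cols-length) (≤-trans (bicliqueSize-≥ m) rows-length))))
    where
    open Biclique K
    q = base m ^ i
    fx fy : ℕ → ℕ
    fx z = t₀ * q + z
    fy a = t₁ * q + a
    split : ∀ {i i′ j j′ : ℕ} → i ∷ j ∷ [] ≡ i′ ∷ j′ ∷ [] → i ≡ i′ × j ≡ j′
    split refl = refl , refl
    pair : ∀ {i₁ j₁} → i₁ ∈ cols → j₁ ∈ rows → E (fx i₁) (fy j₁) (R .colour (i₁ ∷ j₁ ∷ [])) × ¬ Linked (2 + m * 2) (fx i₁) (fy j₁)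
    pair i∈ j∈ = bad-pair j _ _ _ (A⊆ _ _ (R .member (complete j∈ i∈)))
    first-col = firstOf cols (≤-trans (bicliqueSize>0 m) cols-length)
    first-row = firstOf rows (≤-trans (bicliqueSize>0 m) rows-length)
    i₀∈ = proj₂ first-col
    j₀∈ = proj₂ first-row

Enc-bad : ∀ m k′ → ∃ λ C → ∀ n → Enc (Forb 3 (suc n) (2 + k′))
            (λ a b → ∀ v → Bad.bad (proj₁ a) (2 + m * 2) v ≡ Bad.bad (proj₁ b) (2 + m * 2) v) (C * suc n ^ 2)
Enc-bad m k′ = codeSize (base m) 2 (d * sparsity m) , λ n →
  let L , lo , hi = powerAbove (base m) (2≤base m) n
  in Enc-≤ (codeSize-bound (base m) 2 (d * sparsity m) n L hi)
       (PeelCode.Enc-peel (base m) d (sparsity m) L (λ H → Bad.bad (proj₁ H) (2 + m * 2))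
         (λ H v e → ∈-vecs⁺ (VAll-mono lo (edges-bounded (proj₁ H) v (Bad.bad⊆edges (proj₁ H) _ v e))))
         (λ H → edges-NoFull H {base m ^ L} ≤-refl (Bad.bad (proj₁ H) (2 + m * 2)) (Bad.bad⊆edges (proj₁ H) _))
         (λ H → bad-rainbow-bound (proj₁ H) m))
  where
  d = suc ((3 + k′) * 2 + (3 + k′) * 2)

-- Here robust paths have one edge fewer than the forbidden cycle, so an edge containing a linked
-- pair would complete it. Hence all edges are bad.
evenCycle : ∀ m → ∃ λ C → ∀ n → Enc (Forb 3 (suc n) (4 + m * 2)) (λ a b → SameEdges (proj₁ a) (proj₁ b)) (C * suc n ^ 2)
evenCycle m = let C , E = Enc-bad m (2 + m * 2) in C , λ n →
  Enc-map (λ a b h → Agree⇒SameEdges (proj₁ a) (proj₁ b) λ v _ → trans (all-bad a v) (trans (h v) (sym (all-bad b v)))) (E n)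
  where
  all-bad : ∀ {n} (H : Forb 3 (suc n) (4 + m * 2)) v → edges (proj₁ H) v ≡ Bad.bad (proj₁ H) (2 + m * 2) v
  all-bad {n} H@(G , _) v@(x ∷ y ∷ z ∷ []) = bool-ext
    (λ e → let e = edges⁻ G v e in bad⁺ (e , unlinked e , unlinked (swap₂₃ e) , unlinked (swap₂₃ (swap₁₂ e))))
    (bad⊆edges v)
    where
    open Triple G
    open Bad G (2 + m * 2)
    cycle : ∀ {x y z} → Robust (2 + m * 2) x y → E x y z → ⊥
    cycle r e = noCycle H (subst (Cycle (IsEdge G) 0) (+-comm (3 + m * 2) 1) (robust-edge⇒cycle {l = 2 + m * 2} r e))
    unlinked : ∀ {x y z} → E x y z → ¬ Linked (2 + m * 2) x y
    unlinked e (_ , inj₁ r) = cycle r e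
    unlinked e (_ , inj₂ r) = cycle r (swap₁₂ e)

-- Edges through a linked pair

module Labels {n : ℕ} (H : RGraph 3 n) (l : ℕ) where
  open Triple H

  -- These describe the vertex x in the link graph of z.
  One Two Isolated : ℕ → ℕ → Set
  One x z      = ∃ λ y → E x y z
  Two x z      = ∃ λ y → E x y z × ∃ λ y′ → E x y′ z × y′ ≢ y
  Isolated x z = ∃ λ y → E x y z × ¬ (∃ λ y′ → E x y′ z × y′ ≢ y) × ¬ (∃ λ x′ → E x′ y z × x′ ≢ x)

  second? : ∀ x z y → Dec (∃ λ y′ → E x y′ z × y′ ≢ y)
  second? x z y = ∃<? n (λ y′ → E? x y′ z ×-dec ¬? (y′ ≟ y)) (λ (e , _) → E-<₂ e)

  other? : ∀ y z x → Dec (∃ λ x′ → E x′ y z × x′ ≢ x)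
  other? y z x = ∃<? n (λ x′ → E? x′ y z ×-dec ¬? (x′ ≟ x)) (λ (e , _) → E-<₁ e)

  one? : ∀ x z → Dec (One x z)
  one? x z = ∃<? n (λ y → E? x y z) E-<₂

  two? : ∀ x z → Dec (Two x z)
  two? x z = ∃<? n (λ y → E? x y z ×-dec second? x z y) (λ (e , _) → E-<₂ e)

  isolated? : ∀ x z → Dec (Isolated x z)
  isolated? x z = ∃<? n (λ y → E? x y z ×-dec (¬? (second? x z y) ×-dec ¬? (other? y z x))) (λ (e , _) → E-<₂ e)

  LinkShape : ℕ → ℕ → ℕ → Set
  LinkShape x y z = One x z × Two y z ⊎ Two x z × One y z ⊎ Isolated x z × Isolated y z

  -- An edge of the link graph of `z` either has an end of degree at least two or is a component by
  -- itself.
  edge⇒LinkShape : ∀ {x y z} → E x y z → LinkShape x y z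
  edge⇒LinkShape {x} {y} {z} e with second? x z y | other? y z x
  ... | yes (y′ , e′ , ne) | _ = inj₂ (inj₁ ((y , e , y′ , e′ , ne) , x , swap₁₂ e))
  ... | no _ | yes (x′ , e′ , ne) = inj₁ ((y , e) , x , swap₁₂ e , x′ , swap₁₂ e′ , ne)
  ... | no ¬s | no ¬o = inj₂ (inj₂ ((y , e , ¬s , ¬o) ,
          x , swap₁₂ e , (λ (x′ , e′ , ne) → ¬o (x′ , swap₁₂ e′ , ne)) , λ (y′ , e′ , ne) → ¬s (y′ , swap₁₂ e′ , ne)))

  module _ (acyclic : Cycle (IsEdge H) 0 (suc l + 2) → ⊥) where

    -- Edges at x and at y in the link of z close a cycle unless they share their other end.
    detour : ∀ {x y z x′ y′} → Linked l x y → E x′ y z → E x y′ z → x′ ≢ x → y′ ≢ y → x′ ≡ y′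
    detour {x} {y} {z} {x′} {y′} (x≢y , r) e e′ x′≢ y′≢ with x′ ≟ y′
    ... | yes eq = eq
    ... | no ne = ⊥-elim (acyclic ([ (λ r → robust-detour⇒cycle x≢y r (swap₁₂ (swap₂₃ (swap₁₂ e))) (swap₂₃ e′) x′≢ y′≢ ne)
                                   , (λ r → robust-detour⇒cycle (x≢y ∘ sym) r (swap₁₂ (swap₂₃ e′)) (swap₂₃ (swap₁₂ e)) y′≢ x′≢ (ne ∘ sym)) ]′ r))

    -- If `x` and `y` were not adjacent in the link of `z`, then `detour` would identify each of the
    -- two neighbours of `y` with the neighbour of `x`.
    One-Two⇒edge : ∀ {x y z} → Linked l x y → One x z → Two y z → E x y z
    One-Two⇒edge {x} {y} {z} lk (y′ , e′) (x₁ , e₁ , x₂ , e₂ , x₂≢x₁) with y′ ≟ y | x₁ ≟ x | x₂ ≟ x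
    ... | yes refl | _ | _ = e′
    ... | no _ | yes refl | _ = swap₁₂ e₁
    ... | no _ | no _ | yes refl = swap₁₂ e₂
    ... | no a | no b | no c = contradiction
          (trans (detour lk (swap₁₂ e₂) e′ c a) (sym (detour lk (swap₁₂ e₁) e′ b a))) x₂≢x₁

    LinkShape⇒edge : ∀ {x y z} → Linked l x y → LinkShape x y z → E x y z
    LinkShape⇒edge lk (inj₁ (o , t)) = One-Two⇒edge lk o t
    LinkShape⇒edge lk (inj₂ (inj₁ (t , o))) = swap₁₂ (One-Two⇒edge (Linked-sym lk) o t)
    LinkShape⇒edge {x} {y} lk (inj₂ (inj₂ ((y′ , e′ , _ , only) , (x′ , e , _)))) with y′ ≟ y | x′ ≟ x
    ... | yes refl | _ = e′
    ... | no _ | yes refl = swap₁₂ e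
    -- Now `x` and `y` have a common neighbour, so the edge at `x` is not isolated.
    ... | no a | no b with refl ← detour lk (swap₁₂ e) e′ b a = ⊥-elim (only (y , e , proj₁ lk ∘ sym))

  label : Fin 4 → Rel 2
  label zero                (x ∷ y ∷ []) = does (linked? l x y)
  label (suc zero)          (x ∷ z ∷ []) = does (one? x z)
  label (suc (suc zero))    (x ∷ z ∷ []) = does (two? x z)
  label (suc (suc (suc _))) (x ∷ z ∷ []) = does (isolated? x z)

does-transfer : ∀ {P Q : Set} (p : Dec P) (q : Dec Q) → does p ≡ does q → P → Q
does-transfer p q e x = does⇒ q (trans (sym e) (dec-true p x))

module _ {n l : ℕ} (H H′ : RGraph 3 n) (acyclic : Cycle (IsEdge H′) 0 (suc l + 2) → ⊥)
         (agree : ∀ c → Agree n (Labels.label H l c) (Labels.label H′ l c)) where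
  open Labels

  transfer-linked-edge : ∀ {x y z} → Triple.Linked H l x y → Triple.E H x y z → Triple.E H′ x y z
  transfer-linked-edge {x} {y} {z} lk e = LinkShape⇒edge H′ l acyclic lk′ shape′
    where
    x< = Triple.E-<₁ H e
    y< = Triple.E-<₂ H e
    z< = Triple.E-<₃ H e
    lk′ : Triple.Linked H′ l x y
    lk′ = does-transfer (Triple.linked? H l x y) (Triple.linked? H′ l x y) (agree zero _ (x< ∷ y< ∷ [])) lk
    one′ : ∀ {u} → u < n → One H l u z → One H′ l u z
    one′ {u} u< = does-transfer (one? H l u z) (one? H′ l u z) (agree (suc zero) _ (u< ∷ z< ∷ []))
    two′ : ∀ {u} → u < n → Two H l u z → Two H′ l u z
    two′ {u} u< = does-transfer (two? H l u z) (two? H′ l u z) (agree (suc (suc zero)) _ (u< ∷ z< ∷ []))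
    iso′ : ∀ {u} → u < n → Isolated H l u z → Isolated H′ l u z
    iso′ {u} u< = does-transfer (isolated? H l u z) (isolated? H′ l u z) (agree (suc (suc (suc zero))) _ (u< ∷ z< ∷ []))
    shape′ : LinkShape H′ l x y z
    shape′ with edge⇒LinkShape H l e
    ... | inj₁ (a , b) = inj₁ (one′ x< a , two′ y< b)
    ... | inj₂ (inj₁ (a , b)) = inj₂ (inj₁ (two′ x< a , one′ y< b))
    ... | inj₂ (inj₂ (a , b)) = inj₂ (inj₂ (iso′ x< a , iso′ y< b))

  transfer-edge : (∀ v → Bad.bad H l v ≡ true → Bad.bad H′ l v ≡ true) → ∀ v → edges H v ≡ true → edges H′ v ≡ true
  transfer-edge bad⊆ v@(x ∷ y ∷ z ∷ []) ev = edges⁺ H′ v (go (edges⁻ H v ev))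
    where
    open Triple H
    open Triple H′ using () renaming (swap₁₂ to swap₁₂′; swap₂₃ to swap₂₃′)
    go : E x y z → Triple.E H′ x y z
    go e with linked? l x y | linked? l x z | linked? l y z
    ... | yes lk | _ | _ = transfer-linked-edge lk e
    ... | no _ | yes lk | _ = swap₂₃′ (transfer-linked-edge lk (swap₂₃ e))
    ... | no _ | no _ | yes lk = swap₁₂′ (swap₂₃′ (transfer-linked-edge lk (swap₂₃ (swap₁₂ e))))
    ... | no a | no b | no c = proj₁ (Bad.bad⁻ H′ l (bad⊆ v (Bad.bad⁺ H l (e , a , b , c))))

Enc-labels : ∀ l {n k} → Enc (Forb 3 n k) (λ a b → ∀ c → Agree n (Labels.label (proj₁ a) l c) (Labels.label (proj₁ b) l c)) (4 * (n ^ 2 * 2))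
Enc-labels l {n} = Enc-∀ 4 (λ c → Enc-relation n (λ H → Labels.label (proj₁ H) l c))

Enc-odd : ∀ {n M} l → Enc (Forb 3 n (suc l + 2)) (λ a b → ∀ v → Bad.bad (proj₁ a) l v ≡ Bad.bad (proj₁ b) l v) M →
          Enc (Forb 3 n (suc l + 2)) (λ a b → SameEdges (proj₁ a) (proj₁ b)) (4 * (n ^ 2 * 2) + M)
Enc-odd l E = Enc-map (λ (H , f) (H′ , f′) (labels , bads) → Agree⇒SameEdges H H′ λ v _ → bool-ext
    (transfer-edge H H′ (noCycle (H′ , f′)) labels (λ v → trans (sym (bads v))) v)
    (transfer-edge H′ H (noCycle (H , f)) (λ c v v< → sym (labels c v v<)) (λ v → trans (bads v)) v))
  (Enc-× (Enc-labels l) E)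

-- Triple systems without triangles

fresh : (l : List ℕ) → ∃ λ c → c ≤ length l × c ∉ l
fresh l =
  let c , c∈ , ok = avoid {Kill = _≡_} _≟_ (upTo (suc (length l))) (Uniqueₚ.upTo⁺ (suc (length l))) l
                      (λ _ _ a b → trans a (sym b)) (≤-reflexive (sym (length-upTo (suc (length l)))))
  in c , s≤s⁻¹ (∈-upTo⁻ c∈) , λ c∈l → ok c∈l refl

module Greedy {A : Set} (_≟ₐ_ : DecidableEquality A) (conflicts : A → List A) where

  colour : List A → A → ℕ
  colour []       x = 0
  colour (a ∷ as) x = if does (x ≟ₐ a) then proj₁ (fresh (map (colour as) (conflicts a))) else colour as x

  colour-bound : ∀ {D} as → (∀ {a} → a ∈ as → length (conflicts a) ≤ D) → ∀ x → colour as x ≤ D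
  colour-bound []       h x = z≤n
  colour-bound (a ∷ as) h x with x ≟ₐ a
  ... | yes _ = ≤-trans (proj₁ (proj₂ (fresh (map (colour as) (conflicts a)))))
                  (≤-trans (≤-reflexive (length-map (colour as) (conflicts a))) (h (here refl)))
  ... | no _  = colour-bound as (h ∘ there) x

  -- The element nearer to the head is coloured later and avoids the colour of the other. Either of
  -- the two may be nearer, so the conflict is required in both directions.
  colour-proper : ∀ as {x y} → x ∈ as → y ∈ as → x ≢ y → x ∈ conflicts y → y ∈ conflicts x → colour as x ≢ colour as y
  colour-proper (a ∷ as) {x} {y} x∈ y∈ x≢y xc yc with x ≟ₐ a | y ≟ₐ a
  ... | yes refl | yes refl = contradiction refl x≢y
  ... | yes refl | no _ = λ e → proj₂ (proj₂ (fresh (map (colour as) (conflicts x)))) (subst (_∈ _) (sym e) (∈-map⁺ (colour as) yc))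
  ... | no _ | yes refl = λ e → proj₂ (proj₂ (fresh (map (colour as) (conflicts y)))) (subst (_∈ _) e (∈-map⁺ (colour as) xc))
  ... | no x≢ | no y≢ = colour-proper as (tail x≢ x∈) (tail y≢ y∈) x≢y xc yc
    where
    tail : ∀ {z} → z ≢ a → z ∈ a ∷ as → z ∈ as
    tail ne (here e)   = contradiction e ne
    tail ne (there z∈) = z∈

-- Without robust paths of length 1 all codegrees are at most 3, so greedy colouring splits
-- the bad edges into boundedly many classes in which no two edges share a pair as below;
-- every triangle in the shadow of a class is then an edge of the class.
module Triangle {n : ℕ} (H : RGraph 3 n) where
  open Triple H
  open Bad H 0

  nbrs : ℕ → ℕ → List ℕ
  nbrs x y = select (λ z → does (E? x y z)) (upTo n)

  ∈-nbrs : ∀ {x y z} → E x y z → z ∈ nbrs x y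
  ∈-nbrs {x} {y} {z} e = ∈-select⁺ _ (∈-upTo⁺ (E-<₃ e)) (dec-true (E? x y z) e)

  -- A path with one edge is an edge through the pair, so a failure of robustness yields `a`, `b`,
  -- `c` that include every third vertex.
  few-nbrs : ∀ {x y} → x ≢ y → ¬ Linked 0 x y → length (nbrs x y) ≤ 3
  few-nbrs {x} {y} x≢y ¬l =
    let a , _ , ¬a = find (Allₚ.¬All⇒Any¬ (λ a → all? (λ b → all? (λ c → path? 0 _ x y) (upTo n)) (upTo n)) (upTo n) (λ r → ¬l (x≢y , inj₁ r)))
        b , _ , ¬b = find (Allₚ.¬All⇒Any¬ (λ b → all? (λ c → path? 0 _ x y) (upTo n)) (upTo n) ¬a)
        c , _ , ¬c = find (Allₚ.¬All⇒Any¬ (λ c → path? 0 _ x y) (upTo n) ¬b)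
    in Unique-⊆-length {ys = a ∷ b ∷ c ∷ []} (select-Unique _ (Uniqueₚ.upTo⁺ n))
         (λ {z} z∈ → covered a b c ¬c (does⇒ (E? x y z) (proj₂ (∈-select⁻ _ (upTo n) z∈))))
    where
    covered : ∀ a b c → ¬ Path 0 (x ∷ y ∷ a ∷ b ∷ c ∷ []) x y → ∀ {z} → E x y z → z ∈ a ∷ b ∷ c ∷ []
    covered a b c ¬p {z} e with z ∈? (a ∷ b ∷ c ∷ [])
    ... | yes z∈ = z∈
    ... | no z∉ = ⊥-elim (¬p (z , (λ { (here eq) → E-≢₁₃ e (sym eq) ; (there (here eq)) → E-≢₂₃ e (sym eq) ; (there (there z∈)) → z∉ z∈ }) , swap₁₂ e))

  -- For three edges over the sides of a triangle, these are the ways in which two of the third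
  -- vertices can coincide, each seen from both tuples. Six lists of at most three entries lead to
  -- 19 colours.
  conflictLists : Vec ℕ 3 → List (List (Vec ℕ 3))
  conflictLists (p ∷ q ∷ r ∷ []) =
    map (λ y → q ∷ y ∷ r ∷ []) (nbrs q r) ∷
    map (λ x → x ∷ p ∷ r ∷ []) (nbrs p r) ∷
    map (λ z → p ∷ r ∷ z ∷ []) (nbrs p r) ∷
    map (λ y → p ∷ y ∷ q ∷ []) (nbrs p q) ∷
    map (λ z → r ∷ q ∷ z ∷ []) (nbrs q r) ∷
    map (λ x → x ∷ q ∷ p ∷ []) (nbrs p q) ∷ []

  conflicts : Vec ℕ 3 → List (Vec ℕ 3)
  conflicts v = List.concat (conflictLists v)

  items : List (Vec ℕ 3)
  items = select bad (vecs n 3)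

  ∈-items : ∀ {x y z} → IsBad x y z → (x ∷ y ∷ z ∷ []) ∈ items
  ∈-items b@(e , _) = ∈-select⁺ bad (∈-vecs⁺ (E-<₁ e ∷ E-<₂ e ∷ E-<₃ e ∷ [])) (bad⁺ b)

  few-conflicts : ∀ {v} → v ∈ items → length (conflicts v) ≤ 18
  few-conflicts {v@(p ∷ q ∷ r ∷ [])} v∈ = length-concat≤ (conflictLists v)
      (≤₃ (nbrs q r) qr ∷ ≤₃ (nbrs p r) pr ∷ ≤₃ (nbrs p r) pr ∷ ≤₃ (nbrs p q) pq ∷ ≤₃ (nbrs q r) qr ∷ ≤₃ (nbrs p q) pq ∷ [])
    where
    b : IsBad p q r
    b = bad⁻ (proj₂ (∈-select⁻ bad (vecs n 3) v∈))
    pq : length (nbrs p q) ≤ 3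
    pq = few-nbrs (E-≢₁₂ (proj₁ b)) (proj₁ (proj₂ b))
    pr : length (nbrs p r) ≤ 3
    pr = few-nbrs (E-≢₁₃ (proj₁ b)) (proj₁ (proj₂ (proj₂ b)))
    qr : length (nbrs q r) ≤ 3
    qr = few-nbrs (E-≢₂₃ (proj₁ b)) (proj₂ (proj₂ (proj₂ b)))
    ≤₃ : ∀ {f : ℕ → Vec ℕ 3} xs → length xs ≤ 3 → length (map f xs) ≤ 3
    ≤₃ {f} xs = ≤-trans (≤-reflexive (length-map f xs))
    length-concat≤ : ∀ xss → All (λ xs → length xs ≤ 3) xss → length (List.concat xss) ≤ length xss * 3
    length-concat≤ [] [] = z≤n
    length-concat≤ (xs ∷ xss) (h ∷ hs) = ≤-trans (≤-reflexive (length-++ xs)) (+-mono-≤ h (length-concat≤ xss hs))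

  open Greedy (≡-dec {n = 3} _≟_) conflicts

  Class : ℕ → ℕ → ℕ → ℕ → Set
  Class c x y z = IsBad x y z × colour items (x ∷ y ∷ z ∷ []) ≡ c

  class? : ∀ c x y z → Dec (Class c x y z)
  class? c x y z = isBad? x y z ×-dec (colour items (x ∷ y ∷ z ∷ []) ≟ c)

  colour< : ∀ v → colour items v < 19
  colour< v = s≤s (colour-bound items few-conflicts v)

  Shadow₁₂ Shadow₁₃ Shadow₂₃ : ℕ → ℕ → ℕ → Set
  Shadow₁₂ c x y = ∃ λ z → Class c x y z
  Shadow₁₃ c x z = ∃ λ y → Class c x y z
  Shadow₂₃ c y z = ∃ λ x → Class c x y z

  shadow₁₂? : ∀ c x y → Dec (Shadow₁₂ c x y)
  shadow₁₂? c x y = ∃<? n (λ z → class? c x y z) (λ ((e , _) , _) → E-<₃ e)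
  shadow₁₃? : ∀ c x z → Dec (Shadow₁₃ c x z)
  shadow₁₃? c x z = ∃<? n (λ y → class? c x y z) (λ ((e , _) , _) → E-<₂ e)
  shadow₂₃? : ∀ c y z → Dec (Shadow₂₃ c y z)
  shadow₂₃? c y z = ∃<? n (λ x → class? c x y z) (λ ((e , _) , _) → E-<₁ e)

  shadow : ℕ → Fin 3 → Rel 2
  shadow c zero          (x ∷ y ∷ []) = does (shadow₁₂? c x y)
  shadow c (suc zero)    (x ∷ z ∷ []) = does (shadow₁₃? c x z)
  shadow c (suc (suc _)) (y ∷ z ∷ []) = does (shadow₂₃? c y z)

  conflicting : ∀ {v vs} w → v ∈ vs → vs ∈ conflictLists w → v ∈ conflicts w
  conflicting w = ∈-concat⁺′

  proper : ∀ {c x y z x′ y′ z′} → Class c x y z → Class c x′ y′ z′ → (x ∷ y ∷ z ∷ []) ≢ (x′ ∷ y′ ∷ z′ ∷ []) →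
           (x ∷ y ∷ z ∷ []) ∈ conflicts (x′ ∷ y′ ∷ z′ ∷ []) → (x′ ∷ y′ ∷ z′ ∷ []) ∈ conflicts (x ∷ y ∷ z ∷ []) → ⊥
  proper (b , e) (b′ , e′) ne c c′ = colour-proper items (∈-items b) (∈-items b′) ne c c′ (trans e (sym e′))

  clash₁₂ : ∀ {c x y z w} → x ≢ w → Class c x w z → Class c w y z → ⊥
  clash₁₂ {c} {x} {y} {z} {w} x≢w a@((ea , _) , _) b@((eb , _) , _) = proper a b (λ { refl → x≢w refl })
    (conflicting (w ∷ y ∷ z ∷ []) (∈-map⁺ (λ x → x ∷ w ∷ z ∷ []) (∈-nbrs (swap₂₃ (swap₁₂ ea)))) (there (here refl)))
    (conflicting (x ∷ w ∷ z ∷ []) (∈-map⁺ (λ y → w ∷ y ∷ z ∷ []) (∈-nbrs (swap₂₃ eb))) (here refl))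

  clash₂₃ : ∀ {c x y z w} → y ≢ w → Class c x y w → Class c x w z → ⊥
  clash₂₃ {c} {x} {y} {z} {w} y≢w a@((ea , _) , _) b@((eb , _) , _) = proper a b (λ { refl → y≢w refl })
    (conflicting (x ∷ w ∷ z ∷ []) (∈-map⁺ (λ y → x ∷ y ∷ w ∷ []) (∈-nbrs (swap₂₃ ea))) (there (there (there (here refl)))))
    (conflicting (x ∷ y ∷ w ∷ []) (∈-map⁺ (λ z → x ∷ w ∷ z ∷ []) (∈-nbrs eb)) (there (there (here refl))))

  clash₁₃ : ∀ {c x y z w} → x ≢ w → Class c x y w → Class c w y z → ⊥
  clash₁₃ {c} {x} {y} {z} {w} x≢w a@((ea , _) , _) b@((eb , _) , _) = proper a b (λ { refl → x≢w refl })
    (conflicting (w ∷ y ∷ z ∷ []) (∈-map⁺ (λ x → x ∷ y ∷ w ∷ []) (∈-nbrs (swap₁₂ (swap₂₃ (swap₁₂ ea))))) (there (there (there (there (there (here refl)))))))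
    (conflicting (x ∷ y ∷ w ∷ []) (∈-map⁺ (λ z → w ∷ y ∷ z ∷ []) (∈-nbrs (swap₁₂ eb))) (there (there (there (there (here refl))))))

  -- If none of the three edges casting the shadows is `x y z` itself, the clashes show that their
  -- third vertices are distinct, and the edges form a linear triangle.
  shadow-triangle : (Cycle (IsEdge H) 0 3 → ⊥) → ∀ {c x y z} → Shadow₁₂ c x y → Shadow₁₃ c x z → Shadow₂₃ c y z → Class c x y z
  shadow-triangle acyclic {c} {x} {y} {z} (z′ , a) (y′ , b) (x′ , d) with z′ ≟ z | y′ ≟ y | x′ ≟ x
  ... | yes refl | _ | _ = a
  ... | no _ | yes refl | _ = b
  ... | no _ | no _ | yes refl = d
  ... | no z′≢ | no y′≢ | no x′≢ = ⊥-elim (acyclic (_ , (x ∷ z′ ∷ []) ∷ (y ∷ x′ ∷ []) ∷ (z ∷ y′ ∷ []) ∷ [] ,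
        step (swap₁₂ ea) (step (swap₁₂ (swap₂₃ (swap₁₂ ed))) (last (swap₂₃ eb))) ,
        (E-≢₁₃ ea ∷ E-≢₁₂ ea ∷ (x′≢ ∘ sym) ∷ E-≢₁₃ eb ∷ E-≢₁₂ eb ∷ []) ∷
        ((E-≢₂₃ ea ∘ sym) ∷ (λ { refl → clash₁₃ (E-≢₁₃ ea) a d }) ∷ z′≢ ∷ (λ { refl → clash₂₃ (E-≢₂₃ ea) a b }) ∷ []) ∷
        ((E-≢₁₂ ed ∘ sym) ∷ E-≢₂₃ ed ∷ (y′≢ ∘ sym) ∷ []) ∷
        (E-≢₁₃ ed ∷ (λ { refl → clash₁₂ (E-≢₁₂ eb) b d }) ∷ []) ∷
        ((E-≢₂₃ eb ∘ sym) ∷ []) ∷ [] ∷ []))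
    where
    ea = proj₁ (proj₁ a)
    eb = proj₁ (proj₁ b)
    ed = proj₁ (proj₁ d)

module _ {n : ℕ} (H H′ : RGraph 3 n) (acyclic : Cycle (IsEdge H′) 0 3 → ⊥)
         (agree : ∀ (c : Fin 19) j → Agree n (Triangle.shadow H (toℕ c) j) (Triangle.shadow H′ (toℕ c) j)) where
  open Triangle

  -- The colourings of the two hypergraphs are unrelated; only the shadows of equally numbered
  -- classes are compared. An edge casts three shadows in its class, and in the other hypergraph
  -- these bound an edge again.
  transfer-bad : ∀ v → Bad.bad H 0 v ≡ true → Bad.bad H′ 0 v ≡ true
  transfer-bad v@(x ∷ y ∷ z ∷ []) bv = Bad.bad⁺ H′ 0 (proj₁ (shadow-triangle H′ acyclic
      (does-transfer (shadow₁₂? H c x y) (shadow₁₂? H′ c x y) (agree _ zero _ (x< ∷ y< ∷ [])) (z , cl))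
      (does-transfer (shadow₁₃? H c x z) (shadow₁₃? H′ c x z) (agree _ (suc zero) _ (x< ∷ z< ∷ [])) (y , cl))
      (does-transfer (shadow₂₃? H c y z) (shadow₂₃? H′ c y z) (agree _ (suc (suc zero)) _ (y< ∷ z< ∷ [])) (x , cl))))
    where
    b = Bad.bad⁻ H 0 bv
    i : Fin 19
    i = fromℕ< (colour< H v)
    c = toℕ i
    cl : Class H c x y z
    cl = b , sym (toℕ-fromℕ< (colour< H v))
    x< = Triple.E-<₁ H (proj₁ b)
    y< = Triple.E-<₂ H (proj₁ b)
    z< = Triple.E-<₃ H (proj₁ b)

Enc-triangle-bad : ∀ {n} → Enc (Forb 3 n 3) (λ a b → ∀ v → Bad.bad (proj₁ a) 0 v ≡ Bad.bad (proj₁ b) 0 v) (19 * (3 * (n ^ 2 * 2)))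
Enc-triangle-bad {n} = Enc-map (λ (H , f) (H′ , f′) sh v → bool-ext
    (transfer-bad H H′ (noCycle (H′ , f′)) sh v)
    (transfer-bad H′ H (noCycle (H , f)) (λ c j v v< → sym (sh c j v v<)) v))
  (Enc-∀ 19 λ c → Enc-∀ 3 λ j → Enc-relation n (λ H → Triangle.shadow (proj₁ H) (toℕ c) j))

triangle : ∃ λ C → ∀ n → Enc (Forb 3 (suc n) 3) (λ a b → SameEdges (proj₁ a) (proj₁ b)) (C * suc n ^ 2)
triangle = 4 * 2 + 19 * (3 * 2) , λ n → subst (Enc _ _) (eq (suc n ^ 2)) (Enc-odd 0 Enc-triangle-bad)
  where
  eq : ∀ y → 4 * (y * 2) + 19 * (3 * (y * 2)) ≡ (4 * 2 + 19 * (3 * 2)) * y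
  eq = solve-∀

oddCycle : ∀ m → ∃ λ C → ∀ n → Enc (Forb 3 (suc n) (5 + m * 2)) (λ a b → SameEdges (proj₁ a) (proj₁ b)) (C * suc n ^ 2)
oddCycle m = let C , E = Enc-bad m (3 + m * 2) in 4 * 2 + C , λ n →
  subst (Enc _ _) (eq C (suc n ^ 2))
    (subst (λ k → Enc (Forb 3 (suc n) k) (λ a b → SameEdges (proj₁ a) (proj₁ b)) (4 * (suc n ^ 2 * 2) + C * suc n ^ 2)) (+-comm (3 + m * 2) 2)
      (Enc-odd (2 + m * 2) (subst (λ k → Enc (Forb 3 (suc n) k) (λ a b → ∀ v → Bad.bad (proj₁ a) (2 + m * 2) v ≡ Bad.bad (proj₁ b) (2 + m * 2) v) (C * suc n ^ 2))
        (+-comm 2 (3 + m * 2)) (E n))))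
  where
  eq : ∀ C y → 4 * (y * 2) + C * y ≡ (4 * 2 + C) * y
  eq = solve-∀

-- The cases together

even∨odd : ∀ k → ∃ λ m → k ≡ m * 2 ⊎ k ≡ suc (m * 2)
even∨odd zero = 0 , inj₁ refl
even∨odd (suc k) with even∨odd k
... | m , inj₁ e = m , inj₂ (cong suc e)
... | m , inj₂ e = suc m , inj₁ (cong suc e)

encoding : ∀ s k → ∃ λ C → ∀ n → Enc (Forb (3 + s) (suc n) (3 + k)) (λ a b → SameEdges (proj₁ a) (proj₁ b)) (C * suc n ^ (2 + s))
encoding (suc s) k = Enc-r≥4 s (suc k)
encoding zero zero = triangle
-- The cycle has `4 + k` edges here, so its parity is that of `k`.
encoding zero (suc k) with even∨odd k
... | m , inj₁ refl = evenCycle m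
... | m , inj₂ refl = oddCycle m

no-vertices : ∀ {r} (H : RGraph (suc r) 0) S → edge H S ≡ false
no-vertices H [] with edge H [] in eq
... | false = refl
... | true with () ← uniform H [] eq

theorem1p1 : ∀ (r k : ℕ) → 3 ≤ r → 3 ≤ k →
    ∃ λ (C : ℕ) → (0 < C) × (∀ (n : ℕ) → CardAtMost r n k (2 ^ (C * n ^ (r ∸ 1))))
theorem1p1 (suc (suc (suc s))) (suc (suc (suc k))) (s≤s (s≤s (s≤s _))) (s≤s (s≤s (s≤s _))) =
  let C , E = encoding s k in suc C , s≤s z≤n , λ
    -- Without vertices the bound is `2 ^ 0`, so a single code must serve, and it does because there
    -- are no edges.
    { zero    → (λ _ → number (suc C * 0 ^ (2 + s)) (replicate _ false)) , λ (H , _) (H′ , _) _ S → trans (no-vertices H S) (sym (no-vertices H′ S))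
    ; (suc n) → Enc⇒CardAtMost (Enc-≤ (*-monoˡ-≤ (suc n ^ (2 + s)) (n≤1+n C)) (E n)) }
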